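{- Let $m$ and $d$ be positive integers, and let $U_{m,d}$ be the uniform matroid of rank $d$ on a set of $m+d$ elements. Write its Kazhdan–Lusztig polynomial as $P_{U_{m,d}}(t)=\sum_{i=0}^{\lfloor (d-1)/2\rfloor} c_{m,d}^i t^i$. Then for every $0\le i\le \lfloor (d-1)/2\rfloor$, \[ c_{m,d}^i=\binom{d+m}{i}\sum_{h=1}^{m}\frac{(-1)^{h+1}h}{d-h-i+m}\binom{d-h-i+m}{d-2i-h}\binom{m+i}{m-h}. \]
   Context: Binomial coefficients $\binom{n}{k}$ with $k<0$ are $0$. For a loopless matroid $M$ with lattice of flats $L(M)$, characteristic polynomial $\chi_M(t)$ and rank $\operatorname{rk} M$, the Kazhdan–Lusztig polynomial $P_M(t)\in\mathbb{Z}[t]$ (Elias–Proudfoot–Wakefield) is the unique assignment such that: $P_M(t)=1$ if $\operatorname{rk}M=0$; $\deg P_M(t)<\frac12\operatorname{rk}M$ if $\operatorname{rk}M>0$; and $t^{\operatorname{rk}M}P_M(t^{ -1})=\sum_{F\in L(M)}\chi_{M_F}(t)P_{M^F}(t)$, where $M_F$ is the restriction (localization) of $M$ to the flat $F$ and $M^F$ is the contraction of $M$ by $F$. -}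

module Defs where

open import Data.Bool using (Bool; true; false; _∧_; _∨_; not; if_then_else_)
open import Data.Nat as ℕ using (ℕ; zero; suc; _+_; _∸_; _≤_; _<_; _⊓_; _≤ᵇ_; _<ᵇ_; _≡ᵇ_)
open import Data.Nat.Combinatorics using (_C_)
open import Data.Integer as ℤ using (ℤ; +_; -[1+_])
open import Data.Rational as ℚ using (ℚ; 0ℚ)
open import Data.Fin using (Fin)
open import Data.Fin.Subset using (Subset; _∪_; _∩_; _─_; ⁅_⁆; ∣_∣; _⊆_; _∈_; inside; outside)
open import Data.Vec using (Vec; []; _∷_; lookup)
open import Data.List as List using (List; []; _∷_; _++_; map; filter; foldr; allFin; upTo)
open import Data.Product using (_×_)
open import Relation.Binary.PropositionalEquality using (_≡_)

-- Matroids on a ground set E ⊆ Fin n, given by a rank function.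
-- Only the values of r on subsets of E are relevant.

record IsLooplessMatroid (n : ℕ) (E : Subset n) (r : Subset n → ℕ) : Set where
  field
    rank-≤-card : ∀ A → A ⊆ E → r A ≤ ∣ A ∣
    rank-mono   : ∀ A B → A ⊆ B → B ⊆ E → r A ≤ r B
    rank-submod : ∀ A B → A ⊆ E → B ⊆ E → r (A ∪ B) + r (A ∩ B) ≤ r A + r B
    loopless    : ∀ e → e ∈ E → r ⁅ e ⁆ ≡ 1

_∈ᵇ_ : ∀ {n} → Fin n → Subset n → Bool
e ∈ᵇ A = lookup A e

_⊆ᵇ_ : ∀ {n} → Subset n → Subset n → Bool
[] ⊆ᵇ [] = true
(x ∷ A) ⊆ᵇ (y ∷ B) = (not x ∨ y) ∧ (A ⊆ᵇ B)

allSubsets : ∀ n → List (Subset n)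
allSubsets zero = [] ∷ []
allSubsets (suc n) = map (outside ∷_) (allSubsets n) ++ map (inside ∷_) (allSubsets n)

subsetsOf : ∀ {n} → Subset n → List (Subset n)
subsetsOf {n} E = List.filterᵇ (λ A → A ⊆ᵇ E) (allSubsets n)

allᵇ : ∀ {A : Set} → (A → Bool) → List A → Bool
allᵇ p = foldr (λ x b → p x ∧ b) true

isFlat : ∀ {n} → Subset n → (Subset n → ℕ) → Subset n → Bool
isFlat {n} E r F =
  (F ⊆ᵇ E) ∧ allᵇ (λ e → not ((e ∈ᵇ E) ∧ not (e ∈ᵇ F)) ∨ (r F <ᵇ r (F ∪ ⁅ e ⁆))) (allFin n)

flats : ∀ {n} → Subset n → (Subset n → ℕ) → List (Subset n)
flats E r = List.filterᵇ (isFlat E r) (subsetsOf E)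

Poly : Set
Poly = ℕ → ℤ

sumℤ : List ℤ → ℤ
sumℤ = foldr ℤ._+_ (+ 0)

0P : Poly
0P _ = + 0

1P : Poly
1P k = if k ≡ᵇ 0 then + 1 else + 0

_+P_ : Poly → Poly → Poly
(p +P q) k = p k ℤ.+ q k

_*P_ : Poly → Poly → Poly
(p *P q) k = sumℤ (map (λ j → p j ℤ.* q (k ∸ j)) (upTo (suc k)))

sumP : List Poly → Poly
sumP = foldr _+P_ 0P

-- t^r p(t^{-1})  (for deg p ≤ r)
revP : ℕ → Poly → Poly
revP r p k = if k ≤ᵇ r then p (r ∸ k) else + 0

charPoly : ∀ {n} → Subset n → (Subset n → ℕ) → Poly
charPoly E r k =
  sumℤ (map (λ A → if (r E ∸ r A) ≡ᵇ k then (ℤ.-1ℤ ℤ.^ ∣ A ∣) else + 0) (subsetsOf E))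

contrRank : ∀ {n} → (Subset n → ℕ) → Subset n → (Subset n → ℕ)
contrRank r F A = r (A ∪ F) ∸ r F

-- Kazhdan–Lusztig assignment: P n E r is the KL polynomial of the
-- matroid (E , r) on Fin n.  The characterisation of
-- Elias–Proudfoot–Wakefield, required on every loopless matroid.
-- (The restriction M_F is (F , r).)

IsKLAssignment : ((n : ℕ) → Subset n → (Subset n → ℕ) → Poly) → Set
IsKLAssignment P =
  ∀ n E r → IsLooplessMatroid n E r →
    (r E ≡ 0 → ∀ k → P n E r k ≡ 1P k)
    × (0 < r E → ∀ k → r E ≤ 2 ℕ.* k → P n E r k ≡ + 0)
    × (∀ k → revP (r E) (P n E r) k
             ≡ sumP (map (λ F → charPoly F r *P P n (E ─ F) (contrRank r F)) (flats E r)) k)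

-- Uniform matroid U_{m,d} on Fin (m + d): ground set everything, rank min(|A|, d)

uniformRank : ∀ {n} → ℕ → Subset n → ℕ
uniformRank d A = ∣ A ∣ ⊓ d

binomℤ : ℕ → ℤ → ℕ
binomℤ n (+ k) = n C k
binomℤ n -[1+ k ] = 0

-- a / b as a rational; (b = 0 never occurs in the theorem, mapped to 0)
frac : ℤ → ℕ → ℚ
frac a zero = 0ℚ
frac a (suc b) = a ℚ./ suc b

toℚ : ℤ → ℚ
toℚ a = a ℚ./ 1

Σ₁ : ℕ → (ℕ → ℚ) → ℚ
Σ₁ zero f = 0ℚ
Σ₁ (suc m) f = Σ₁ m f ℚ.+ f (suc m)

klFormula : ℕ → ℕ → ℕ → ℚ
klFormula m d i =
  toℚ (+ ((d + m) C i)) ℚ.*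
  Σ₁ m (λ h →
    frac ((ℤ.-1ℤ ℤ.^ (h + 1)) ℤ.* (+ h)
           ℤ.* (+ (binomℤ (d ∸ h ∸ i + m) (+ d ℤ.- + (2 ℕ.* i) ℤ.- + h)
                   ℕ.* ((m + i) C (m ∸ h)))))
         (d ∸ h ∸ i + m))

{-# OPTIONS --safe #-}
module Submission where

-- Write m = μ + 1 and let T(a,i) be the h-sum of the formula with d = a + i, so that the claim is
-- c_{m,d}^i = C(m+d,i) T(d−i,i).  The flats of U_{m,d} other than the ground set are the sets of size j < d;
-- restricting to such a flat gives a Boolean matroid and contracting it gives U_{m,d−j}.  For 2k < d and
-- D = d − k, the coefficient of t^D in the defining equation therefore expresses c_{m,d}^k through smaller d:
--   c_{m,d}^k = (−1)^k C(m+d,k) + Σ_j C(m+d,j) Σ_s (−1)^s C(j,s) c_{m,d−j}^{D−j+s}.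
-- Inserting the claim and grouping by s turns the inner sum into a multiple of G(D,k−s), where
-- G(a,b) = Σ_i C(a,i) T(b,i).  The key fact is that G(a,b) b! (m+a)! is symmetric in a and b: up to the symmetric
-- factor (a+b)! (m−1)! it equals Σ_{l<m} (m−l) C(a−1+l,l) C(b−1+l,l).  After exchanging the
-- arguments, the alternating sum over s is a k-th finite difference, which inverts the binomial transform G
-- and returns C(m+d,k) T(D,k).  To stay within ℤ, T(a,i) and G(a,b) are multiplied by a and b (U and H below).

open import Defs
open import Data.Bool using (Bool; true; false; T; if_then_else_; not; _∧_; _∨_)
open import Data.Bool.Properties using (∧-zeroʳ)
open import Data.Fin using (Fin)
open import Data.Fin.Subset using (Subset; ⊤; ⊥; _∪_; _∩_; _─_; ⁅_⁆; ∣_∣; _⊆_; _∈_; _∉_; inside; outside)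
open import Data.Fin.Subset.Properties
open import Data.Integer as ℤ using (ℤ; +_)
import Data.Integer.Properties as ℤ
open import Data.Integer.Tactic.RingSolver using (solve-∀)
open import Data.List as List using (List; []; _∷_; map; _++_; allFin; upTo; applyUpTo)
import Data.List.Properties as List
open import Data.List.Membership.Propositional using () renaming (_∈_ to _∈ˡ_)
open import Data.List.Membership.Propositional.Properties using (∈-allFin)
open import Data.List.Relation.Unary.Any using (here; there)
open import Data.Nat as ℕ using (ℕ; zero; suc; _+_; _≤_; _<_; ⌊_/2⌋; _∸_; z≤n; s≤s; _!; _≤ᵇ_; _<ᵇ_; _≡ᵇ_; _⊓_)
import Data.Nat.Properties as ℕ
open import Data.Nat.Combinatorics using (_C_; nCk+nC[k+1]≡[n+1]C[k+1])
open import Data.Nat.Combinatorics.Specification using (k>n⇒nCk≡0)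
open import Data.Nat.Induction using (<-rec)
import Data.Nat.Tactic.RingSolver as ℕ-Solver
open import Data.Product using (_,_; _×_; ∃; proj₁; proj₂)
open import Data.Rational as ℚ using (ℚ)
import Data.Rational.Properties as ℚ
open import Data.Rational.Unnormalised as ℚᵘ using (mkℚᵘ; *≡*)
import Data.Rational.Unnormalised.Properties as ℚᵘ
open import Data.Sum using (inj₁; inj₂)
open import Data.Vec as Vec using ([]; _∷_; lookup)
open import Data.Vec.Properties using ([]=⇒lookup; lookup⇒[]=)
open import Relation.Nullary using (yes; no; contradiction; ¬_)
open import Relation.Binary.PropositionalEquality using (_≡_; _≢_; ≢-sym; refl; sym; trans; cong; cong₂; subst; module ≡-Reasoning)

-- Finite sums

-- Reversal moves c_{m,d}^k to the coefficient of t^D, D = d - k, and 2k < d gives 2D > d. At that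
-- exponent the flat ∅, whose term is the unknown polynomial itself, contributes 0; this is what
-- makes the equation a recurrence in d. Grouping by s works because along a fixed s every
-- coefficient that occurs has the same difference of rank and degree, namely p = k - s. It has the
-- form c_{m,p+i}^i, and the claim gives it the factor T(p,i) with p fixed, so that summing over i
-- produces G(D,p). This needs the full range of i, also beyond the middle degree. The claim does
-- extend there: for d ≤ 2i both T(d-i,i) and the coefficient are 0. The recurrence yields G(D,p),
-- whereas the difference that inverts the transform needs G(p,D) with D fixed and p varying. The
-- symmetry of G bridges exactly this gap.

∑ : ℕ → (ℕ → ℤ) → ℤ
∑ zero    f = + 0
∑ (suc n) f = f 0 ℤ.+ ∑ n (λ i → f (suc i))

∑-cong : ∀ n {f g} → (∀ i → i < n → f i ≡ g i) → ∑ n f ≡ ∑ n g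
∑-cong zero    h = refl
∑-cong (suc n) h = cong₂ ℤ._+_ (h 0 (s≤s z≤n)) (∑-cong n (λ i i<n → h (suc i) (s≤s i<n)))

∑-zero : ∀ n {f} → (∀ i → i < n → f i ≡ + 0) → ∑ n f ≡ + 0
∑-zero zero    h = refl
∑-zero (suc n) h = cong₂ ℤ._+_ (h 0 (s≤s z≤n)) (∑-zero n (λ i i<n → h (suc i) (s≤s i<n)))

∑-+ : ∀ n f g → ∑ n (λ i → f i ℤ.+ g i) ≡ ∑ n f ℤ.+ ∑ n g
∑-+ zero    f g = refl
∑-+ (suc n) f g = trans
  (cong (ℤ._+_ (f 0 ℤ.+ g 0)) (∑-+ n (λ i → f (suc i)) (λ i → g (suc i))))
  (interchange (f 0) (g 0) (∑ n (λ i → f (suc i))) (∑ n (λ i → g (suc i))))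
  where
  interchange : ∀ a b c d → (a ℤ.+ b) ℤ.+ (c ℤ.+ d) ≡ (a ℤ.+ c) ℤ.+ (b ℤ.+ d)
  interchange = solve-∀

*-∑ : ∀ n c f → c ℤ.* ∑ n f ≡ ∑ n (λ i → c ℤ.* f i)
*-∑ zero    c f = ℤ.*-zeroʳ c
*-∑ (suc n) c f = trans
  (ℤ.*-distribˡ-+ c (f 0) (∑ n (λ i → f (suc i))))
  (cong (ℤ._+_ (c ℤ.* f 0)) (*-∑ n c (λ i → f (suc i))))

∑-* : ∀ n f c → ∑ n f ℤ.* c ≡ ∑ n (λ i → f i ℤ.* c)
∑-* zero    f c = refl
∑-* (suc n) f c = trans
  (ℤ.*-distribʳ-+ c (f 0) (∑ n (λ i → f (suc i))))
  (cong (ℤ._+_ (f 0 ℤ.* c)) (∑-* n (λ i → f (suc i)) c))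

∑-swap : ∀ m n (f : ℕ → ℕ → ℤ) → ∑ m (λ i → ∑ n (f i)) ≡ ∑ n (λ j → ∑ m (λ i → f i j))
∑-swap zero    n f = sym (∑-zero n (λ _ _ → refl))
∑-swap (suc m) n f =
  trans (cong (ℤ._+_ (∑ n (f 0))) (∑-swap m n (λ i → f (suc i))))
        (sym (∑-+ n (f 0) (λ j → ∑ m (λ i → f (suc i) j))))

∑-split : ∀ m n f → ∑ (m + n) f ≡ ∑ m f ℤ.+ ∑ n (λ i → f (m + i))
∑-split zero    n f = sym (ℤ.+-identityˡ _)
∑-split (suc m) n f = trans
  (cong (ℤ._+_ (f 0)) (∑-split m n (λ i → f (suc i))))
  (sym (ℤ.+-assoc (f 0) (∑ m (λ i → f (suc i))) (∑ n (λ i → f (suc m + i)))))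

∑-last : ∀ n f → ∑ (suc n) f ≡ ∑ n f ℤ.+ f n
∑-last zero    f = ℤ.+-comm (f 0) (+ 0)
∑-last (suc n) f = trans
  (cong (ℤ._+_ (f 0)) (∑-last n (λ i → f (suc i))))
  (sym (ℤ.+-assoc (f 0) (∑ n (λ i → f (suc i))) (f (suc n))))

∑-reverse : ∀ n f → ∑ (suc n) f ≡ ∑ (suc n) (λ i → f (n ∸ i))
∑-reverse zero    f = refl
∑-reverse (suc n) f = begin
  f 0 ℤ.+ ∑ (suc n) (λ i → f (suc i))
    ≡⟨ ℤ.+-comm (f 0) _ ⟩
  ∑ (suc n) (λ i → f (suc i)) ℤ.+ f 0
    ≡⟨ cong₂ ℤ._+_ (∑-reverse n (λ i → f (suc i))) (cong f (sym (ℕ.n∸n≡0 n))) ⟩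
  ∑ (suc n) (λ i → f (suc (n ∸ i))) ℤ.+ f (suc n ∸ suc n)
    ≡⟨ cong (ℤ._+ f (suc n ∸ suc n)) (∑-cong (suc n) (λ i i<n → cong f (sym (ℕ.+-∸-assoc 1 (ℕ.≤-pred i<n))))) ⟩
  ∑ (suc n) (λ i → f (suc n ∸ i)) ℤ.+ f (suc n ∸ suc n)
    ≡⟨ ∑-last (suc n) (λ i → f (suc n ∸ i)) ⟨
  ∑ (suc (suc n)) (λ i → f (suc n ∸ i)) ∎
  where open ≡-Reasoning

∑-extend : ∀ {m n} → m ≤ n → ∀ f → (∀ i → m ≤ i → i < n → f i ≡ + 0) → ∑ n f ≡ ∑ m f
∑-extend {m} m≤n f f≡0 with ℕ.m≤n⇒∃[o]m+o≡n m≤n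
... | k , refl = begin
  ∑ (m + k) f                        ≡⟨ ∑-split m k f ⟩
  ∑ m f ℤ.+ ∑ k (λ i → f (m + i))    ≡⟨ cong (ℤ._+_ (∑ m f)) (∑-zero k (λ i i<k → f≡0 (m + i) (ℕ.m≤m+n m i) (ℕ.+-monoʳ-< m i<k))) ⟩
  ∑ m f ℤ.+ + 0                      ≡⟨ ℤ.+-identityʳ _ ⟩
  ∑ m f                              ∎
  where open ≡-Reasoning

-- The common shape of the exchanges of summation below: a transform in one index passes through a
-- sum over the other and acts on the kernel `f` alone.
∑-*-∑ : ∀ M N (c d : ℕ → ℤ) (f : ℕ → ℕ → ℤ) →
        ∑ N (λ i → d i ℤ.* ∑ M (λ h → c h ℤ.* f h i)) ≡ ∑ M (λ h → c h ℤ.* ∑ N (λ i → d i ℤ.* f h i))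
∑-*-∑ M N c d f = begin
  ∑ N (λ i → d i ℤ.* ∑ M (λ h → c h ℤ.* f h i))
    ≡⟨ ∑-cong N (λ i _ → *-∑ M (d i) (λ h → c h ℤ.* f h i)) ⟩
  ∑ N (λ i → ∑ M (λ h → d i ℤ.* (c h ℤ.* f h i)))
    ≡⟨ ∑-swap N M (λ i h → d i ℤ.* (c h ℤ.* f h i)) ⟩
  ∑ M (λ h → ∑ N (λ i → d i ℤ.* (c h ℤ.* f h i)))
    ≡⟨ ∑-cong M (λ h _ → ∑-cong N (λ i _ → ring (d i) (c h) (f h i))) ⟩
  ∑ M (λ h → ∑ N (λ i → c h ℤ.* (d i ℤ.* f h i)))
    ≡⟨ ∑-cong M (λ h _ → *-∑ N (c h) (λ i → d i ℤ.* f h i)) ⟨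
  ∑ M (λ h → c h ℤ.* ∑ N (λ i → d i ℤ.* f h i)) ∎
  where
  open ≡-Reasoning
  ring : ∀ x y z → x ℤ.* (y ℤ.* z) ≡ y ℤ.* (x ℤ.* z)
  ring = solve-∀

-- Binomial coefficients

sgn : ℕ → ℤ
sgn n = ℤ.-1ℤ ℤ.^ n

-- Pascal's rule with values in ℤ, so that inductive steps hold by computation and sign
-- cancellations need no casts; `bin≡C` translates to `_C_` at the end.
bin : ℕ → ℕ → ℤ
bin n       zero    = + 1
bin zero    (suc k) = + 0
bin (suc n) (suc k) = bin n k ℤ.+ bin n (suc k)

bin≡C : ∀ n k → bin n k ≡ + (n C k)
bin≡C zero    zero    = refl
bin≡C (suc n) zero    = refl
bin≡C zero    (suc k) = cong +_ (sym (k>n⇒nCk≡0 {0} {suc k} (s≤s z≤n)))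
bin≡C (suc n) (suc k) =
  trans (cong₂ ℤ._+_ (bin≡C n k) (bin≡C n (suc k))) (cong +_ (nCk+nC[k+1]≡[n+1]C[k+1] n k))

n<k⇒bin≡0 : ∀ {n k} → n < k → bin n k ≡ + 0
n<k⇒bin≡0 {zero}  {suc k} _         = refl
n<k⇒bin≡0 {suc n} {suc k} (s≤s n<k) = cong₂ ℤ._+_ (n<k⇒bin≡0 n<k) (n<k⇒bin≡0 (ℕ.m<n⇒m<1+n n<k))

bin-nn : ∀ n → bin n n ≡ + 1
bin-nn zero    = refl
bin-nn (suc n) = cong₂ ℤ._+_ (bin-nn n) (n<k⇒bin≡0 (ℕ.n<1+n n))

fact : ℕ → ℤ
fact n = + (n !)

fact-suc : ∀ n → fact (suc n) ≡ + suc n ℤ.* fact n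
fact-suc n = ℤ.pos-* (suc n) (n !)

*-cancel-fact : ∀ n {x y} → x ℤ.* fact n ≡ y ℤ.* fact n → x ≡ y
*-cancel-fact n = ℤ.*-cancelʳ-≡ _ _ (fact n) {{n ℕ.!≢0}}

-- In Pascal's rule each of the two binomial coefficients takes one of the factors a + 1 and b + 1,
-- and these add up to a + b + 2. With `*-cancel-fact` this replaces division: product identities
-- are multiplied by factorials until both sides are products of factorials.
bin-fact : ∀ a b → bin (a + b) a ℤ.* (fact a ℤ.* fact b) ≡ fact (a + b)
bin-fact zero b = identity (fact b)
  where
  identity : ∀ x → + 1 ℤ.* (+ 1 ℤ.* x) ≡ x
  identity = solve-∀
bin-fact (suc a) zero rewrite ℕ.+-identityʳ a | bin-nn a | n<k⇒bin≡0 (ℕ.n<1+n a) = identity (fact (suc a))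
  where
  identity : ∀ x → + 1 ℤ.* (x ℤ.* + 1) ≡ x
  identity = solve-∀
bin-fact (suc a) (suc b) = begin
  (bin (a + suc b) a ℤ.+ bin (a + suc b) (suc a)) ℤ.* (fact (suc a) ℤ.* fact (suc b))
    ≡⟨ distrib (bin (a + suc b) a) (bin (a + suc b) (suc a)) (+ suc a) (+ suc b) (fact a) (fact b) (fact-suc a) (fact-suc b) ⟩
  + suc a ℤ.* (bin (a + suc b) a ℤ.* (fact a ℤ.* fact (suc b)))
    ℤ.+ + suc b ℤ.* (bin (a + suc b) (suc a) ℤ.* (fact (suc a) ℤ.* fact b))
    ≡⟨ cong₂ (λ x y → + suc a ℤ.* x ℤ.+ + suc b ℤ.* y) (bin-fact a (suc b))
         (trans (cong (λ z → bin z (suc a) ℤ.* (fact (suc a) ℤ.* fact b)) (ℕ.+-suc a b))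
                (trans (bin-fact (suc a) b) (cong fact (sym (ℕ.+-suc a b))))) ⟩
  + suc a ℤ.* fact (a + suc b) ℤ.+ + suc b ℤ.* fact (a + suc b)
    ≡⟨ ℤ.*-distribʳ-+ (fact (a + suc b)) (+ suc a) (+ suc b) ⟨
  + suc (a + suc b) ℤ.* fact (a + suc b)
    ≡⟨ fact-suc (a + suc b) ⟨
  fact (suc a + suc b) ∎
  where
  open ≡-Reasoning
  distrib : ∀ x y u v f g {f′ g′} → f′ ≡ u ℤ.* f → g′ ≡ v ℤ.* g →
            (x ℤ.+ y) ℤ.* (f′ ℤ.* g′) ≡ u ℤ.* (x ℤ.* (f ℤ.* g′)) ℤ.+ v ℤ.* (y ℤ.* (f′ ℤ.* g))
  distrib x y u v f g refl refl = ring x y u v f g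
    where
    ring : ∀ x y u v f g → (x ℤ.+ y) ℤ.* ((u ℤ.* f) ℤ.* (v ℤ.* g))
             ≡ u ℤ.* (x ℤ.* (f ℤ.* (v ℤ.* g))) ℤ.+ v ℤ.* (y ℤ.* ((u ℤ.* f) ℤ.* g))
    ring = solve-∀

bin-fact′ : ∀ {n} a b → n ≡ a + b → bin n a ℤ.* (fact a ℤ.* fact b) ≡ fact n
bin-fact′ a b refl = bin-fact a b

bin-sym : ∀ a b → bin (a + b) a ≡ bin (a + b) b
bin-sym a b = *-cancel-fact a (*-cancel-fact b (begin
  bin (a + b) a ℤ.* fact a ℤ.* fact b     ≡⟨ ℤ.*-assoc (bin (a + b) a) (fact a) (fact b) ⟩
  bin (a + b) a ℤ.* (fact a ℤ.* fact b)   ≡⟨ bin-fact a b ⟩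
  fact (a + b)                            ≡⟨ bin-fact′ b a (ℕ.+-comm a b) ⟨
  bin (a + b) b ℤ.* (fact b ℤ.* fact a)   ≡⟨ ring (bin (a + b) b) (fact a) (fact b) ⟩
  bin (a + b) b ℤ.* fact a ℤ.* fact b     ∎))
  where
  open ≡-Reasoning
  ring : ∀ x y z → x ℤ.* (z ℤ.* y) ≡ x ℤ.* y ℤ.* z
  ring = solve-∀

-- The binomial transform of `f` at `a`.
binSum : ℕ → (ℕ → ℤ) → ℤ
binSum a f = ∑ (suc a) (λ i → bin a i ℤ.* f i)

binSum-extend : ∀ {a n} → a < n → ∀ f → ∑ n (λ i → bin a i ℤ.* f i) ≡ binSum a f
binSum-extend {a} a<n f = ∑-extend a<n _ (λ i a<i _ → cong (ℤ._* f i) (n<k⇒bin≡0 a<i))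

binSum-suc : ∀ a f → binSum (suc a) f ≡ binSum a f ℤ.+ binSum a (λ i → f (suc i))
binSum-suc a f = begin
  + 1 ℤ.* f 0 ℤ.+ ∑ (suc a) (λ i → (bin a i ℤ.+ bin a (suc i)) ℤ.* f (suc i))
    ≡⟨ cong (ℤ._+_ (+ 1 ℤ.* f 0))
         (trans (∑-cong (suc a) (λ i _ → ℤ.*-distribʳ-+ (f (suc i)) (bin a i) (bin a (suc i))))
                (∑-+ (suc a) (λ i → bin a i ℤ.* f (suc i)) (λ i → bin a (suc i) ℤ.* f (suc i)))) ⟩
  + 1 ℤ.* f 0 ℤ.+ (binSum a (λ i → f (suc i)) ℤ.+ ∑ (suc a) (λ i → bin a (suc i) ℤ.* f (suc i)))
    ≡⟨ shuffle (+ 1 ℤ.* f 0) (binSum a (λ i → f (suc i))) (∑ (suc a) (λ i → bin a (suc i) ℤ.* f (suc i))) ⟩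
  ∑ (suc (suc a)) (λ i → bin a i ℤ.* f i) ℤ.+ binSum a (λ i → f (suc i))
    ≡⟨ cong (ℤ._+ binSum a (λ i → f (suc i))) (binSum-extend (ℕ.m<n⇒m<1+n (ℕ.n<1+n a)) f) ⟩
  binSum a f ℤ.+ binSum a (λ i → f (suc i)) ∎
  where
  open ≡-Reasoning
  shuffle : ∀ x y z → x ℤ.+ (y ℤ.+ z) ≡ (x ℤ.+ z) ℤ.+ y
  shuffle = solve-∀

-- Vandermonde with one lower index reflected. The induction on `a` keeps `h` free because its step
-- shifts `h`.
binSum-bin : ∀ a b h → binSum a (λ i → bin b (i + h)) ≡ bin (a + b) (a + h)
binSum-bin zero    b h = trans (ℤ.+-identityʳ _) (ℤ.*-identityˡ _)
binSum-bin (suc a) b h = begin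
  binSum (suc a) (λ i → bin b (i + h))
    ≡⟨ binSum-suc a (λ i → bin b (i + h)) ⟩
  binSum a (λ i → bin b (i + h)) ℤ.+ binSum a (λ i → bin b (suc i + h))
    ≡⟨ cong (ℤ._+_ (binSum a (λ i → bin b (i + h)))) (∑-cong (suc a) (λ i _ → cong (λ z → bin a i ℤ.* bin b z) (sym (ℕ.+-suc i h)))) ⟩
  binSum a (λ i → bin b (i + h)) ℤ.+ binSum a (λ i → bin b (i + suc h))
    ≡⟨ cong₂ ℤ._+_ (binSum-bin a b h) (binSum-bin a b (suc h)) ⟩
  bin (a + b) (a + h) ℤ.+ bin (a + b) (a + suc h)
    ≡⟨ cong (λ z → bin (a + b) (a + h) ℤ.+ bin (a + b) z) (ℕ.+-suc a h) ⟩
  bin (suc a + b) (suc a + h) ∎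
  where open ≡-Reasoning

vandermonde : ∀ a b n → ∑ (suc n) (λ q → bin a q ℤ.* bin b (n ∸ q)) ≡ bin (a + b) n
vandermonde zero    b n =
  trans (cong₂ ℤ._+_ (ℤ.*-identityˡ (bin b n)) (∑-zero n (λ _ _ → refl))) (ℤ.+-identityʳ (bin b n))
vandermonde (suc a) b zero    = refl
vandermonde (suc a) b (suc n) = begin
  + 1 ℤ.* bin b (suc n) ℤ.+ ∑ (suc n) (λ q → (bin a q ℤ.+ bin a (suc q)) ℤ.* bin b (n ∸ q))
    ≡⟨ cong (ℤ._+_ (+ 1 ℤ.* bin b (suc n)))
         (trans (∑-cong (suc n) (λ q _ → ℤ.*-distribʳ-+ (bin b (n ∸ q)) (bin a q) (bin a (suc q))))
                (∑-+ (suc n) (λ q → bin a q ℤ.* bin b (n ∸ q)) (λ q → bin a (suc q) ℤ.* bin b (n ∸ q)))) ⟩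
  + 1 ℤ.* bin b (suc n) ℤ.+ (∑ (suc n) (λ q → bin a q ℤ.* bin b (n ∸ q)) ℤ.+ ∑ (suc n) (λ q → bin a (suc q) ℤ.* bin b (n ∸ q)))
    ≡⟨ shuffle (+ 1 ℤ.* bin b (suc n)) (∑ (suc n) (λ q → bin a q ℤ.* bin b (n ∸ q)))
         (∑ (suc n) (λ q → bin a (suc q) ℤ.* bin b (n ∸ q))) ⟩
  ∑ (suc n) (λ q → bin a q ℤ.* bin b (n ∸ q)) ℤ.+ ∑ (suc (suc n)) (λ q → bin a q ℤ.* bin b (suc n ∸ q))
    ≡⟨ cong₂ ℤ._+_ (vandermonde a b n) (vandermonde a b (suc n)) ⟩
  bin (suc a + b) (suc n) ∎
  where
  open ≡-Reasoning
  shuffle : ∀ x y z → x ℤ.+ (y ℤ.+ z) ≡ y ℤ.+ (x ℤ.+ z)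
  shuffle = solve-∀

-- The k-th forward difference of `f` at 0, which inverts `binSum`.
difference : ℕ → (ℕ → ℤ) → ℤ
difference k f = binSum k (λ s → sgn s ℤ.* f (k ∸ s))

difference-suc : ∀ k f → difference (suc k) f ≡ difference k (λ p → f (suc p) ℤ.- f p)
difference-suc k f = begin
  difference (suc k) f
    ≡⟨ binSum-suc k (λ s → sgn s ℤ.* f (suc k ∸ s)) ⟩
  binSum k (λ s → sgn s ℤ.* f (suc k ∸ s)) ℤ.+ binSum k (λ s → sgn (suc s) ℤ.* f (k ∸ s))
    ≡⟨ ∑-+ (suc k) (λ s → bin k s ℤ.* (sgn s ℤ.* f (suc k ∸ s))) (λ s → bin k s ℤ.* (sgn (suc s) ℤ.* f (k ∸ s))) ⟨
  ∑ (suc k) (λ s → bin k s ℤ.* (sgn s ℤ.* f (suc k ∸ s)) ℤ.+ bin k s ℤ.* (sgn (suc s) ℤ.* f (k ∸ s)))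
    ≡⟨ ∑-cong (suc k) (λ s s<k → trans (cong (λ z → bin k s ℤ.* (sgn s ℤ.* f z) ℤ.+ bin k s ℤ.* (sgn (suc s) ℤ.* f (k ∸ s))) (ℕ.+-∸-assoc 1 (ℕ.≤-pred s<k)))
                                      (ring (bin k s) (sgn s) (f (suc (k ∸ s))) (f (k ∸ s)))) ⟩
  difference k (λ p → f (suc p) ℤ.- f p) ∎
  where
  open ≡-Reasoning
  ring : ∀ b s x y → b ℤ.* (s ℤ.* x) ℤ.+ b ℤ.* ((ℤ.-1ℤ ℤ.* s) ℤ.* y) ≡ b ℤ.* (s ℤ.* (x ℤ.- y))
  ring = solve-∀

difference-cong : ∀ k {f g} → (∀ p → f p ≡ g p) → difference k f ≡ difference k g
difference-cong k f≡g = ∑-cong (suc k) (λ s _ → cong (λ z → bin k s ℤ.* (sgn s ℤ.* z)) (f≡g (k ∸ s)))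

-- The inverse of `binSum-bin`: by Pascal's rule, one difference of C(p + b, p + h) in p is C(p + b,
-- p + h + 1), so k differences raise `h` by k and leave the value at p = 0.
difference-bin : ∀ k b h → difference k (λ p → bin (p + b) (p + h)) ≡ bin b (k + h)
difference-bin zero    b h = ring (bin b h)
  where
  ring : ∀ x → + 1 ℤ.* (+ 1 ℤ.* x) ℤ.+ + 0 ≡ x
  ring = solve-∀
difference-bin (suc k) b h = begin
  difference (suc k) (λ p → bin (p + b) (p + h))
    ≡⟨ difference-suc k (λ p → bin (p + b) (p + h)) ⟩
  difference k (λ p → (bin (p + b) (p + h) ℤ.+ bin (p + b) (suc (p + h))) ℤ.- bin (p + b) (p + h))
    ≡⟨ difference-cong k (λ p → trans (cancel (bin (p + b) (p + h)) (bin (p + b) (suc (p + h)))) (cong (bin (p + b)) (sym (ℕ.+-suc p h)))) ⟩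
  difference k (λ p → bin (p + b) (p + suc h))
    ≡⟨ difference-bin k b (suc h) ⟩
  bin b (k + suc h)
    ≡⟨ cong (bin b) (ℕ.+-suc k h) ⟩
  bin b (suc k + h) ∎
  where
  open ≡-Reasoning
  cancel : ∀ x y → (x ℤ.+ y) ℤ.- x ≡ y
  cancel = solve-∀

-- Both sides are the trinomial coefficient (x + u + v)! / (x! u! v!).
trinomial : ∀ x u v → bin (x + (u + v)) (x + u) ℤ.* bin (x + u) x ≡ bin (x + (u + v)) (u + v) ℤ.* bin (u + v) u
trinomial x u v = *-cancel-fact x (*-cancel-fact u (*-cancel-fact v
  (trans (ringˡ (bin (x + (u + v)) (x + u)) (bin (x + u) x) (fact x) (fact u) (fact v))
  (trans (trans (cong₂ ℤ._*_ (cong (λ z → bin z (x + u)) (sym (ℕ.+-assoc x u v))) (cong (ℤ._* fact v) (bin-fact x u)))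
                (trans (bin-fact (x + u) v) (cong fact (ℕ.+-assoc x u v))))
  (sym
  (trans (ringʳ (bin (x + (u + v)) (u + v)) (bin (u + v) u) (fact x) (fact u) (fact v))
         (trans (cong₂ ℤ._*_ (cong (λ z → bin z (u + v)) (ℕ.+-comm x (u + v))) (cong (ℤ._* fact x) (bin-fact u v)))
                (trans (bin-fact (u + v) x) (cong fact (ℕ.+-comm (u + v) x))))))))))
  where
  ringˡ : ∀ p q a b c → p ℤ.* q ℤ.* a ℤ.* b ℤ.* c ≡ p ℤ.* ((q ℤ.* (a ℤ.* b)) ℤ.* c)
  ringˡ = solve-∀
  ringʳ : ∀ p q a b c → p ℤ.* q ℤ.* a ℤ.* b ℤ.* c ≡ p ℤ.* ((q ℤ.* (b ℤ.* c)) ℤ.* a)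
  ringʳ = solve-∀

-- The symmetry of the binomial transform

weight : ℕ → ℤ
weight h = sgn h ℤ.* + suc h

-- The part of a summand of the formula that does not depend on `i`, once its denominator has been
-- absorbed (see `absorb`). In `U` the index `i` is left in a single binomial coefficient, so
-- transforms over `i` act on that one alone.
coeff : ℕ → ℕ → ℕ → ℤ
coeff μ β h = weight h ℤ.* bin (β + (μ ∸ h)) (μ ∸ h)

-- In U, H and V the summation index is h − 1 in the notation of the formula, and m = suc μ.
-- U μ β i is (β+1) T(β+1,i), and H μ a β is (β+1) G(a,β+1).
U : ℕ → ℕ → ℕ → ℤ
U μ β i = ∑ (suc μ) (λ h → coeff μ β h ℤ.* bin (suc β) (i + suc h))

H : ℕ → ℕ → ℕ → ℤ
H μ a β = ∑ (suc μ) (λ h → coeff μ β h ℤ.* bin (a + suc β) (a + suc h))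

V : ℕ → ℕ → ℕ → ℤ
V μ a β = ∑ (suc μ) (λ h → weight h ℤ.* (bin (β + (μ ∸ h)) μ ℤ.* bin (suc μ + a) (μ ∸ h)))

∑-bin-U : ∀ μ β {a n} → a < n → ∑ n (λ i → bin a i ℤ.* U μ β i) ≡ H μ a β
∑-bin-U μ β {a} {n} a<n = begin
  ∑ n (λ i → bin a i ℤ.* U μ β i)
    ≡⟨ ∑-*-∑ (suc μ) n (coeff μ β) (bin a) (λ h i → bin (suc β) (i + suc h)) ⟩
  ∑ (suc μ) (λ h → coeff μ β h ℤ.* ∑ n (λ i → bin a i ℤ.* bin (suc β) (i + suc h)))
    ≡⟨ ∑-cong (suc μ) (λ h _ → cong (coeff μ β h ℤ.*_)
         (trans (binSum-extend a<n (λ i → bin (suc β) (i + suc h))) (binSum-bin a (suc β) (suc h)))) ⟩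
  H μ a β ∎
  where open ≡-Reasoning

-- Recovers T from its binomial transform G, termwise by `difference-bin`.
difference-H : ∀ μ β k → difference k (λ p → H μ p β) ≡ U μ β k
difference-H μ β k = begin
  difference k (λ p → H μ p β)
    ≡⟨ ∑-cong (suc k) (λ s _ → sym (ℤ.*-assoc (bin k s) (sgn s) (H μ (k ∸ s) β))) ⟩
  ∑ (suc k) (λ s → bin k s ℤ.* sgn s ℤ.* H μ (k ∸ s) β)
    ≡⟨ ∑-*-∑ (suc μ) (suc k) (coeff μ β) (λ s → bin k s ℤ.* sgn s) (λ h s → bin (k ∸ s + suc β) (k ∸ s + suc h)) ⟩
  ∑ (suc μ) (λ h → coeff μ β h ℤ.* ∑ (suc k) (λ s → bin k s ℤ.* sgn s ℤ.* bin (k ∸ s + suc β) (k ∸ s + suc h)))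
    ≡⟨ ∑-cong (suc μ) (λ h _ → cong (coeff μ β h ℤ.*_) (trans
         (∑-cong (suc k) (λ s _ → ℤ.*-assoc (bin k s) (sgn s) (bin (k ∸ s + suc β) (k ∸ s + suc h))))
         (difference-bin k (suc β) (suc h)))) ⟩
  U μ β k ∎
  where open ≡-Reasoning

-- For h ≤ β both sides equal (β + y)! (a + β + 1)! (y + h + 1 + a)! divided by y! (a + h + 1)! (β -
-- h)!. For h > β each side contains a binomial coefficient that is 0. Here `y` stands for μ - h.
H-V-term : ∀ y h a β →
  bin (β + y) y ℤ.* bin (a + suc β) (a + suc h) ℤ.* (fact β ℤ.* fact (suc (y + h) + a)) ≡
  bin (β + y) (y + h) ℤ.* bin (suc (y + h) + a) y ℤ.* (fact (y + h) ℤ.* fact (a + suc β))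
H-V-term y h a β with h ℕ.≤? β
... | no h≰β = trans
  (cong (ℤ._* (fact β ℤ.* fact (suc (y + h) + a))) (trans (cong (bin (β + y) y ℤ.*_) left) (ℤ.*-zeroʳ (bin (β + y) y))))
  (sym (cong (λ z → z ℤ.* bin (suc (y + h) + a) y ℤ.* (fact (y + h) ℤ.* fact (a + suc β))) right))
  where
  left : bin (a + suc β) (a + suc h) ≡ + 0
  left = n<k⇒bin≡0 (ℕ.+-monoʳ-< a (s≤s (ℕ.≰⇒> h≰β)))
  right : bin (β + y) (y + h) ≡ + 0
  right = n<k⇒bin≡0 (ℕ.<-≤-trans (ℕ.+-monoˡ-< y (ℕ.≰⇒> h≰β)) (ℕ.≤-reflexive (ℕ.+-comm h y)))
... | yes h≤β with ℕ.m≤n⇒∃[o]m+o≡n h≤β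
... | z , refl = *-cancel-fact y (*-cancel-fact (a + suc h) (*-cancel-fact z (begin
  A ℤ.* B ℤ.* (fact β ℤ.* N₃) ℤ.* fy ℤ.* fah ℤ.* fz
    ≡⟨ ring₁ A B (fact β) N₃ fy fah fz ⟩
  (A ℤ.* (fy ℤ.* fact β)) ℤ.* (B ℤ.* (fah ℤ.* fz)) ℤ.* N₃
    ≡⟨ cong₂ (λ u v → u ℤ.* v ℤ.* N₃) (bin-fact′ y β (ℕ.+-comm β y)) (bin-fact′ (a + suc h) z (sym (ℕ.+-assoc a (suc h) z))) ⟩
  N₁ ℤ.* N₂ ℤ.* N₃
    ≡⟨ ring₂ N₁ N₂ N₃ ⟩
  N₁ ℤ.* N₃ ℤ.* N₂
    ≡⟨ cong₂ (λ u v → u ℤ.* v ℤ.* N₂)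
         (bin-fact′ (y + h) z (trans (ℕ.+-comm (h + z) y) (sym (ℕ.+-assoc y h z))))
         (bin-fact′ y (a + suc h) (trans (cong suc (ℕ.+-assoc y h a)) (trans (sym (ℕ.+-suc y (h + a))) (cong (ℕ._+_ y) (ℕ.+-comm (suc h) a))))) ⟨
  (G ℤ.* (fact (y + h) ℤ.* fz)) ℤ.* (D ℤ.* (fy ℤ.* fah)) ℤ.* N₂
    ≡⟨ ring₃ G D (fact (y + h)) N₂ fy fah fz ⟨
  G ℤ.* D ℤ.* (fact (y + h) ℤ.* N₂) ℤ.* fy ℤ.* fah ℤ.* fz ∎)))
  where
  open ≡-Reasoning
  A B G D fy fah fz N₁ N₂ N₃ : ℤ
  A = bin (β + y) y
  B = bin (a + suc β) (a + suc h)
  G = bin (β + y) (y + h)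
  D = bin (suc (y + h) + a) y
  fy = fact y
  fah = fact (a + suc h)
  fz = fact z
  N₁ = fact (β + y)
  N₂ = fact (a + suc β)
  N₃ = fact (suc (y + h) + a)
  ring₁ : ∀ A B f N fy fah fz → A ℤ.* B ℤ.* (f ℤ.* N) ℤ.* fy ℤ.* fah ℤ.* fz ≡ (A ℤ.* (fy ℤ.* f)) ℤ.* (B ℤ.* (fah ℤ.* fz)) ℤ.* N
  ring₁ = solve-∀
  ring₂ : ∀ x y z → x ℤ.* y ℤ.* z ≡ x ℤ.* z ℤ.* y
  ring₂ = solve-∀
  ring₃ : ∀ A B f N fy fah fz → A ℤ.* B ℤ.* (f ℤ.* N) ℤ.* fy ℤ.* fah ℤ.* fz ≡ (A ℤ.* (f ℤ.* fz)) ℤ.* (B ℤ.* (fy ℤ.* fah)) ℤ.* N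
  ring₃ = solve-∀

-- The factor on the right is symmetric under exchanging a and β + 1, so the symmetry of the scaled
-- G reduces to that of `V`, whose summands have a shape that Vandermonde can open.
H-V : ∀ μ a β → H μ a β ℤ.* (fact β ℤ.* fact (suc μ + a)) ≡ V μ a β ℤ.* (fact μ ℤ.* fact (a + suc β))
H-V μ a β = begin
  H μ a β ℤ.* c
    ≡⟨ ∑-* (suc μ) (λ h → coeff μ β h ℤ.* bin (a + suc β) (a + suc h)) c ⟩
  ∑ (suc μ) (λ h → coeff μ β h ℤ.* bin (a + suc β) (a + suc h) ℤ.* c)
    ≡⟨ ∑-cong (suc μ) (λ h h<μ → begin
         coeff μ β h ℤ.* bin (a + suc β) (a + suc h) ℤ.* c
           ≡⟨ ring₁ (weight h) (bin (β + (μ ∸ h)) (μ ∸ h)) (bin (a + suc β) (a + suc h)) c ⟩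
         weight h ℤ.* (bin (β + (μ ∸ h)) (μ ∸ h) ℤ.* bin (a + suc β) (a + suc h) ℤ.* c)
           ≡⟨ cong (weight h ℤ.*_) (subst (λ z →
                bin (β + (μ ∸ h)) (μ ∸ h) ℤ.* bin (a + suc β) (a + suc h) ℤ.* (fact β ℤ.* fact (suc z + a)) ≡
                bin (β + (μ ∸ h)) z ℤ.* bin (suc z + a) (μ ∸ h) ℤ.* (fact z ℤ.* fact (a + suc β)))
                (ℕ.m∸n+n≡m (ℕ.≤-pred h<μ)) (H-V-term (μ ∸ h) h a β)) ⟩
         weight h ℤ.* (bin (β + (μ ∸ h)) μ ℤ.* bin (suc μ + a) (μ ∸ h) ℤ.* d)
           ≡⟨ ℤ.*-assoc (weight h) (bin (β + (μ ∸ h)) μ ℤ.* bin (suc μ + a) (μ ∸ h)) d ⟨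
         weight h ℤ.* (bin (β + (μ ∸ h)) μ ℤ.* bin (suc μ + a) (μ ∸ h)) ℤ.* d ∎) ⟩
  ∑ (suc μ) (λ h → weight h ℤ.* (bin (β + (μ ∸ h)) μ ℤ.* bin (suc μ + a) (μ ∸ h)) ℤ.* d)
    ≡⟨ ∑-* (suc μ) (λ h → weight h ℤ.* (bin (β + (μ ∸ h)) μ ℤ.* bin (suc μ + a) (μ ∸ h))) d ⟨
  V μ a β ℤ.* d ∎
  where
  open ≡-Reasoning
  c d : ℤ
  c = fact β ℤ.* fact (suc μ + a)
  d = fact μ ℤ.* fact (a + suc β)
  ring₁ : ∀ w x y c → w ℤ.* x ℤ.* y ℤ.* c ≡ w ℤ.* (x ℤ.* y ℤ.* c)
  ring₁ = solve-∀

-- Division of (1 + x)^n by 1 + x and its square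

alternating : ℕ → ℕ → ℤ
alternating n q = ∑ (suc q) (λ h → sgn h ℤ.* bin n (q ∸ h))

-- The coefficient of x^q in (1 + x)^n / (1 + x)^2, as `alternating` is that of (1 + x)^n / (1 + x).
weighted : ℕ → ℕ → ℤ
weighted n q = ∑ (suc q) (λ h → weight h ℤ.* bin n (q ∸ h))

alternating-suc : ∀ n q → alternating n (suc q) ≡ bin n (suc q) ℤ.- alternating n q
alternating-suc n q = begin
  + 1 ℤ.* bin n (suc q) ℤ.+ ∑ (suc q) (λ h → sgn (suc h) ℤ.* bin n (q ∸ h))
    ≡⟨ cong₂ ℤ._+_ (ℤ.*-identityˡ (bin n (suc q))) (trans
         (∑-cong (suc q) (λ h _ → ℤ.*-assoc ℤ.-1ℤ (sgn h) (bin n (q ∸ h))))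
         (trans (sym (*-∑ (suc q) ℤ.-1ℤ (λ h → sgn h ℤ.* bin n (q ∸ h)))) (ℤ.-1*i≡-i (alternating n q)))) ⟩
  bin n (suc q) ℤ.- alternating n q ∎
  where open ≡-Reasoning

weighted-suc : ∀ n q → weighted n (suc q) ≡ bin n (suc q) ℤ.- (weighted n q ℤ.+ alternating n q)
weighted-suc n q = begin
  + 1 ℤ.* bin n (suc q) ℤ.+ ∑ (suc q) (λ h → weight (suc h) ℤ.* bin n (q ∸ h))
    ≡⟨ cong₂ ℤ._+_ (ℤ.*-identityˡ (bin n (suc q))) (begin
         ∑ (suc q) (λ h → weight (suc h) ℤ.* bin n (q ∸ h))
           ≡⟨ ∑-cong (suc q) (λ h _ → ring (sgn h) (+ suc h) (bin n (q ∸ h))) ⟩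
         ∑ (suc q) (λ h → ℤ.-1ℤ ℤ.* (weight h ℤ.* bin n (q ∸ h) ℤ.+ sgn h ℤ.* bin n (q ∸ h)))
           ≡⟨ *-∑ (suc q) ℤ.-1ℤ (λ h → weight h ℤ.* bin n (q ∸ h) ℤ.+ sgn h ℤ.* bin n (q ∸ h)) ⟨
         ℤ.-1ℤ ℤ.* ∑ (suc q) (λ h → weight h ℤ.* bin n (q ∸ h) ℤ.+ sgn h ℤ.* bin n (q ∸ h))
           ≡⟨ ℤ.-1*i≡-i _ ⟩
         ℤ.- ∑ (suc q) (λ h → weight h ℤ.* bin n (q ∸ h) ℤ.+ sgn h ℤ.* bin n (q ∸ h))
           ≡⟨ cong ℤ.-_ (∑-+ (suc q) (λ h → weight h ℤ.* bin n (q ∸ h)) (λ h → sgn h ℤ.* bin n (q ∸ h))) ⟩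
         ℤ.- (weighted n q ℤ.+ alternating n q) ∎) ⟩
  bin n (suc q) ℤ.- (weighted n q ℤ.+ alternating n q) ∎
  where
  open ≡-Reasoning
  ring : ∀ s k y → (ℤ.-1ℤ ℤ.* s) ℤ.* (+ 1 ℤ.+ k) ℤ.* y ≡ ℤ.-1ℤ ℤ.* (s ℤ.* k ℤ.* y ℤ.+ s ℤ.* y)
  ring = solve-∀

alternating≡bin : ∀ n q → alternating (suc n) q ≡ bin n q
alternating≡bin n zero    = refl
alternating≡bin n (suc q) = begin
  alternating (suc n) (suc q)                                ≡⟨ alternating-suc (suc n) q ⟩
  (bin n q ℤ.+ bin n (suc q)) ℤ.- alternating (suc n) q      ≡⟨ cong (λ z → (bin n q ℤ.+ bin n (suc q)) ℤ.- z) (alternating≡bin n q) ⟩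
  (bin n q ℤ.+ bin n (suc q)) ℤ.- bin n q                    ≡⟨ ring (bin n q) (bin n (suc q)) ⟩
  bin n (suc q)                                              ∎
  where
  open ≡-Reasoning
  ring : ∀ x y → (x ℤ.+ y) ℤ.- x ≡ y
  ring = solve-∀

-- Dividing by (1 + x)^2 lowers the exponent by two, provided that it is at least two. In
-- `V-weighted` the exponent is a + 1 + q, hence `V-closed` takes a = α + 1 and a = 0 is treated
-- apart in `V-0`.
weighted≡bin : ∀ n q → weighted (suc (suc n)) q ≡ bin n q
weighted≡bin n zero    = refl
weighted≡bin n (suc q) = begin
  weighted (suc (suc n)) (suc q)
    ≡⟨ weighted-suc (suc (suc n)) q ⟩
  bin (suc (suc n)) (suc q) ℤ.- (weighted (suc (suc n)) q ℤ.+ alternating (suc (suc n)) q)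
    ≡⟨ cong (λ z → bin (suc (suc n)) (suc q) ℤ.- z) (cong₂ ℤ._+_ (weighted≡bin n q) (alternating≡bin (suc n) q)) ⟩
  (bin (suc n) q ℤ.+ (bin n q ℤ.+ bin n (suc q))) ℤ.- (bin n q ℤ.+ bin (suc n) q)
    ≡⟨ ring (bin (suc n) q) (bin n q) (bin n (suc q)) ⟩
  bin n (suc q) ∎
  where
  open ≡-Reasoning
  ring : ∀ x y z → (x ℤ.+ (y ℤ.+ z)) ℤ.- (y ℤ.+ x) ≡ z
  ring = solve-∀

-- Vandermonde on C(β+μ−h, μ), then the sum over h is Σ_h (−1)^h (h+1) C(a+1+q, q−h).
V-weighted : ∀ μ a β → V μ a β ≡ ∑ (suc μ) (λ q → bin β q ℤ.* (bin (suc μ + a) (suc a + q) ℤ.* weighted (suc a + q) q))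
V-weighted μ a β = begin
  V μ a β
    ≡⟨ ∑-cong (suc μ) (λ h _ → cong (weight h ℤ.*_) (begin
         bin (β + (μ ∸ h)) μ ℤ.* bin (suc μ + a) (μ ∸ h)
           ≡⟨ cong (ℤ._* bin (suc μ + a) (μ ∸ h)) (vandermonde β (μ ∸ h) μ) ⟨
         ∑ (suc μ) (λ q → bin β q ℤ.* bin (μ ∸ h) (μ ∸ q)) ℤ.* bin (suc μ + a) (μ ∸ h)
           ≡⟨ ∑-* (suc μ) (λ q → bin β q ℤ.* bin (μ ∸ h) (μ ∸ q)) (bin (suc μ + a) (μ ∸ h)) ⟩
         ∑ (suc μ) (λ q → bin β q ℤ.* bin (μ ∸ h) (μ ∸ q) ℤ.* bin (suc μ + a) (μ ∸ h))
           ≡⟨ ∑-cong (suc μ) (λ q _ → ℤ.*-assoc (bin β q) (bin (μ ∸ h) (μ ∸ q)) (bin (suc μ + a) (μ ∸ h))) ⟩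
         ∑ (suc μ) (λ q → bin β q ℤ.* inner q h) ∎)) ⟩
  ∑ (suc μ) (λ h → weight h ℤ.* ∑ (suc μ) (λ q → bin β q ℤ.* inner q h))
    ≡⟨ ∑-*-∑ (suc μ) (suc μ) (bin β) weight inner ⟩
  ∑ (suc μ) (λ q → bin β q ℤ.* ∑ (suc μ) (λ h → weight h ℤ.* inner q h))
    ≡⟨ ∑-cong (suc μ) (λ q q<μ → cong (bin β q ℤ.*_) (inner-sum q (ℕ.≤-pred q<μ))) ⟩
  ∑ (suc μ) (λ q → bin β q ℤ.* (bin (suc μ + a) (suc a + q) ℤ.* weighted (suc a + q) q)) ∎
  where
  open ≡-Reasoning
  inner : ℕ → ℕ → ℤ
  inner q h = bin (μ ∸ h) (μ ∸ q) ℤ.* bin (suc μ + a) (μ ∸ h)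

  inner-zero : ∀ q h → q < h → h ≤ μ → inner q h ≡ + 0
  inner-zero q h q<h h≤μ = cong (ℤ._* bin (suc μ + a) (μ ∸ h)) (n<k⇒bin≡0 (ℕ.∸-monoʳ-< q<h h≤μ))

  inner-trinomial : ∀ q h → h ≤ q → q ≤ μ → inner q h ≡ bin (suc μ + a) (suc a + q) ℤ.* bin (suc a + q) (q ∸ h)
  inner-trinomial q h h≤q q≤μ = begin
    bin (μ ∸ h) x ℤ.* bin (suc μ + a) (μ ∸ h)          ≡⟨ ℤ.*-comm (bin (μ ∸ h) x) (bin (suc μ + a) (μ ∸ h)) ⟩
    bin (suc μ + a) (μ ∸ h) ℤ.* bin (μ ∸ h) x          ≡⟨ cong₂ (λ s t → bin s t ℤ.* bin t x) total x+u ⟩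
    -- This step moves all dependence on h into the second factor: u + v = a + 1 + q is free of h.
    bin (x + (u + v)) (x + u) ℤ.* bin (x + u) x        ≡⟨ trinomial x u v ⟩
    bin (x + (u + v)) (u + v) ℤ.* bin (u + v) u        ≡⟨ cong₂ (λ s t → bin s t ℤ.* bin t u) (sym total) u+v ⟩
    bin (suc μ + a) (suc a + q) ℤ.* bin (suc a + q) u  ∎
    where
    x u v : ℕ
    x = μ ∸ q
    u = q ∸ h
    v = suc a + h
    u+v : u + v ≡ suc a + q
    u+v = trans (ℕ.+-comm u v) (trans (ℕ.+-assoc (suc a) h u) (cong (ℕ._+_ (suc a)) (ℕ.m+[n∸m]≡n h≤q)))
    x+u : μ ∸ h ≡ x + u
    x+u = trans (cong (_∸ h) (sym (ℕ.m∸n+n≡m q≤μ))) (ℕ.+-∸-assoc x h≤q)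
    total : suc μ + a ≡ x + (u + v)
    total = sym (trans (cong (ℕ._+_ x) (trans u+v (ℕ.+-comm (suc a) q))) (trans (sym (ℕ.+-assoc x q (suc a)))
              (trans (cong (_+ suc a) (ℕ.m∸n+n≡m q≤μ)) (ℕ.+-suc μ a))))

  inner-sum : ∀ q → q ≤ μ → ∑ (suc μ) (λ h → weight h ℤ.* inner q h) ≡ bin (suc μ + a) (suc a + q) ℤ.* weighted (suc a + q) q
  inner-sum q q≤μ = begin
    ∑ (suc μ) (λ h → weight h ℤ.* inner q h)
      ≡⟨ ∑-extend (s≤s q≤μ) (λ h → weight h ℤ.* inner q h)
           (λ h q<h h<μ → trans (cong (weight h ℤ.*_) (inner-zero q h q<h (ℕ.≤-pred h<μ))) (ℤ.*-zeroʳ (weight h))) ⟩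
    ∑ (suc q) (λ h → weight h ℤ.* inner q h)
      ≡⟨ ∑-cong (suc q) (λ h h<q → trans (cong (weight h ℤ.*_) (inner-trinomial q h (ℕ.≤-pred h<q) q≤μ))
           (ring (weight h) K (bin (suc a + q) (q ∸ h)))) ⟩
    ∑ (suc q) (λ h → K ℤ.* (weight h ℤ.* bin (suc a + q) (q ∸ h)))
      ≡⟨ *-∑ (suc q) K (λ h → weight h ℤ.* bin (suc a + q) (q ∸ h)) ⟨
    K ℤ.* weighted (suc a + q) q ∎
    where
    K : ℤ
    K = bin (suc μ + a) (suc a + q)
    ring : ∀ w k b → w ℤ.* (k ℤ.* b) ≡ k ℤ.* (w ℤ.* b)
    ring = solve-∀

-- Hockey-stick sums and the closed form of V

hockey-stick : ∀ μ α q → ∑ (suc μ) (λ l → bin (α + l) (α + q)) ≡ bin (suc μ + α) (suc α + q)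
hockey-stick zero α q = begin
  bin (α + 0) (α + q) ℤ.+ + 0                  ≡⟨ cong₂ ℤ._+_ (cong (λ z → bin z (α + q)) (ℕ.+-identityʳ α)) (sym (n<k⇒bin≡0 (s≤s (ℕ.m≤m+n α q)))) ⟩
  bin α (α + q) ℤ.+ bin α (suc (α + q))        ∎
  where open ≡-Reasoning
hockey-stick (suc μ) α q = begin
  ∑ (suc (suc μ)) (λ l → bin (α + l) (α + q))
    ≡⟨ ∑-last (suc μ) (λ l → bin (α + l) (α + q)) ⟩
  ∑ (suc μ) (λ l → bin (α + l) (α + q)) ℤ.+ bin (α + suc μ) (α + q)
    ≡⟨ cong₂ ℤ._+_ (hockey-stick μ α q) (cong (λ z → bin z (α + q)) (ℕ.+-comm α (suc μ))) ⟩
  bin (suc μ + α) (suc (α + q)) ℤ.+ bin (suc μ + α) (α + q)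
    ≡⟨ ℤ.+-comm (bin (suc μ + α) (suc (α + q))) (bin (suc μ + α) (α + q)) ⟩
  bin (suc (suc μ) + α) (suc α + q) ∎
  where open ≡-Reasoning

∑-decreasing-suc : ∀ μ (g : ℕ → ℤ) →
  ∑ (suc (suc μ)) (λ l → + (suc (suc μ) ∸ l) ℤ.* g l) ≡
  ∑ (suc μ) (λ l → + (suc μ ∸ l) ℤ.* g l) ℤ.+ ∑ (suc (suc μ)) g
∑-decreasing-suc μ g = begin
  ∑ (suc (suc μ)) (λ l → + (suc (suc μ) ∸ l) ℤ.* g l)
    ≡⟨ ∑-cong (suc (suc μ)) (λ l l<μ → trans (cong (λ z → + z ℤ.* g l) (ℕ.+-∸-assoc 1 (ℕ.≤-pred l<μ))) (ring (+ (suc μ ∸ l)) (g l))) ⟩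
  ∑ (suc (suc μ)) (λ l → + (suc μ ∸ l) ℤ.* g l ℤ.+ g l)
    ≡⟨ ∑-+ (suc (suc μ)) (λ l → + (suc μ ∸ l) ℤ.* g l) g ⟩
  ∑ (suc (suc μ)) (λ l → + (suc μ ∸ l) ℤ.* g l) ℤ.+ ∑ (suc (suc μ)) g
    ≡⟨ cong (ℤ._+ ∑ (suc (suc μ)) g) (∑-extend (ℕ.n≤1+n (suc μ)) (λ l → + (suc μ ∸ l) ℤ.* g l)
         (λ l μ<l _ → cong (λ z → + z ℤ.* g l) (ℕ.m≤n⇒m∸n≡0 μ<l))) ⟩
  ∑ (suc μ) (λ l → + (suc μ ∸ l) ℤ.* g l) ℤ.+ ∑ (suc (suc μ)) g ∎
  where
  open ≡-Reasoning
  ring : ∀ k x → (+ 1 ℤ.+ k) ℤ.* x ≡ k ℤ.* x ℤ.+ x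
  ring = solve-∀

-- The factor `suc μ ∸ l` counts the partial sums that contain the l-th term, so this is the
-- hockey-stick identity summed once more. It is the source of the weight m - l in the symmetric
-- sum.
double-hockey-stick : ∀ μ α q →
  ∑ (suc μ) (λ l → + (suc μ ∸ l) ℤ.* bin (α + l) (α + q)) ≡ bin (suc μ + suc α) (suc (suc α) + q)
double-hockey-stick zero α q = begin
  + 1 ℤ.* bin (α + 0) (α + q) ℤ.+ + 0                 ≡⟨ cong (ℤ._+ + 0) (ℤ.*-identityˡ (bin (α + 0) (α + q))) ⟩
  bin (α + 0) (α + q) ℤ.+ + 0                         ≡⟨ hockey-stick 0 α q ⟩
  bin (suc α) (suc α + q)                             ≡⟨ ℤ.+-identityʳ (bin (suc α) (suc α + q)) ⟨
  bin (suc α) (suc α + q) ℤ.+ + 0                     ≡⟨ cong (ℤ._+_ (bin (suc α) (suc α + q))) (sym (n<k⇒bin≡0 (s≤s (s≤s (ℕ.m≤m+n α q))))) ⟩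
  bin (suc (suc α)) (suc (suc α) + q)                 ∎
  where open ≡-Reasoning
double-hockey-stick (suc μ) α q = begin
  ∑ (suc (suc μ)) (λ l → + (suc (suc μ) ∸ l) ℤ.* bin (α + l) (α + q))
    ≡⟨ ∑-decreasing-suc μ (λ l → bin (α + l) (α + q)) ⟩
  ∑ (suc μ) (λ l → + (suc μ ∸ l) ℤ.* bin (α + l) (α + q)) ℤ.+ ∑ (suc (suc μ)) (λ l → bin (α + l) (α + q))
    ≡⟨ cong₂ ℤ._+_ (double-hockey-stick μ α q)
         (trans (hockey-stick (suc μ) α q) (cong (λ z → bin z (suc α + q)) (sym (ℕ.+-suc (suc μ) α)))) ⟩
  bin (suc μ + suc α) (suc (suc α) + q) ℤ.+ bin (suc μ + suc α) (suc α + q)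
    ≡⟨ ℤ.+-comm (bin (suc μ + suc α) (suc (suc α) + q)) (bin (suc μ + suc α) (suc α + q)) ⟩
  bin (suc (suc μ) + suc α) (suc (suc α) + q) ∎
  where open ≡-Reasoning

bin-bin : ∀ α l q → bin (α + l) (α + q) ℤ.* bin (α + q) q ≡ bin (α + l) l ℤ.* bin l q
bin-bin α l q with q ℕ.≤? l
... | no q≰l = trans
  (cong (ℤ._* bin (α + q) q) (n<k⇒bin≡0 (ℕ.+-monoʳ-< α (ℕ.≰⇒> q≰l))))
  (sym (trans (cong (bin (α + l) l ℤ.*_) (n<k⇒bin≡0 (ℕ.≰⇒> q≰l))) (ℤ.*-zeroʳ (bin (α + l) l))))
... | yes q≤l with ℕ.m≤n⇒∃[o]m+o≡n q≤l
... | v , refl = trans (cong (bin (α + (q + v)) (α + q) ℤ.*_) (sym (bin-sym α q))) (trinomial α q v)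

-- Opening C(m + a, a + 1 + q) by `double-hockey-stick` introduces l and separates `α` from `β`: the
-- first leaves C(α + l, l) C(l, q), and the remaining sum of C(l, q) C(β, q) over q is Vandermonde
-- again.
V-closed : ∀ μ α β → V μ (suc α) β ≡ ∑ (suc μ) (λ l → + (suc μ ∸ l) ℤ.* (bin (α + l) l ℤ.* bin (β + l) l))
V-closed μ α β = begin
  V μ (suc α) β
    ≡⟨ V-weighted μ (suc α) β ⟩
  ∑ (suc μ) (λ q → bin β q ℤ.* (bin (suc μ + suc α) (suc (suc α) + q) ℤ.* weighted (suc (suc (α + q))) q))
    ≡⟨ ∑-cong (suc μ) (λ q _ → cong (bin β q ℤ.*_) (begin
         bin (suc μ + suc α) (suc (suc α) + q) ℤ.* weighted (suc (suc (α + q))) q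
           ≡⟨ cong₂ ℤ._*_ (sym (double-hockey-stick μ α q)) (weighted≡bin (α + q) q) ⟩
         ∑ (suc μ) (λ l → + (suc μ ∸ l) ℤ.* bin (α + l) (α + q)) ℤ.* bin (α + q) q
           ≡⟨ ∑-* (suc μ) (λ l → + (suc μ ∸ l) ℤ.* bin (α + l) (α + q)) (bin (α + q) q) ⟩
         ∑ (suc μ) (λ l → + (suc μ ∸ l) ℤ.* bin (α + l) (α + q) ℤ.* bin (α + q) q)
           ≡⟨ ∑-cong (suc μ) (λ l _ → trans (ℤ.*-assoc (+ (suc μ ∸ l)) (bin (α + l) (α + q)) (bin (α + q) q))
                (cong (+ (suc μ ∸ l) ℤ.*_) (bin-bin α l q))) ⟩
         ∑ (suc μ) (λ l → + (suc μ ∸ l) ℤ.* (bin (α + l) l ℤ.* bin l q)) ∎)) ⟩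
  ∑ (suc μ) (λ q → bin β q ℤ.* ∑ (suc μ) (λ l → + (suc μ ∸ l) ℤ.* (bin (α + l) l ℤ.* bin l q)))
    ≡⟨ ∑-*-∑ (suc μ) (suc μ) (λ l → + (suc μ ∸ l)) (bin β) (λ l q → bin (α + l) l ℤ.* bin l q) ⟩
  ∑ (suc μ) (λ l → + (suc μ ∸ l) ℤ.* ∑ (suc μ) (λ q → bin β q ℤ.* (bin (α + l) l ℤ.* bin l q)))
    ≡⟨ ∑-cong (suc μ) (λ l l<μ → cong (+ (suc μ ∸ l) ℤ.*_) (begin
         ∑ (suc μ) (λ q → bin β q ℤ.* (bin (α + l) l ℤ.* bin l q))
           ≡⟨ ∑-cong (suc μ) (λ q _ → ring (bin β q) (bin (α + l) l) (bin l q)) ⟩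
         ∑ (suc μ) (λ q → bin (α + l) l ℤ.* (bin l q ℤ.* bin β q))
           ≡⟨ *-∑ (suc μ) (bin (α + l) l) (λ q → bin l q ℤ.* bin β q) ⟨
         bin (α + l) l ℤ.* ∑ (suc μ) (λ q → bin l q ℤ.* bin β q)
           ≡⟨ cong (bin (α + l) l ℤ.*_) (begin
                ∑ (suc μ) (λ q → bin l q ℤ.* bin β q)      ≡⟨ binSum-extend l<μ (bin β) ⟩
                binSum l (bin β)                           ≡⟨ ∑-cong (suc l) (λ q _ → cong (λ z → bin l q ℤ.* bin β z) (sym (ℕ.+-identityʳ q))) ⟩
                binSum l (λ q → bin β (q + 0))             ≡⟨ binSum-bin l β 0 ⟩
                bin (l + β) (l + 0)                        ≡⟨ cong₂ bin (ℕ.+-comm l β) (ℕ.+-identityʳ l) ⟩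
                bin (β + l) l                              ∎) ⟩
         bin (α + l) l ℤ.* bin (β + l) l ∎)) ⟩
  ∑ (suc μ) (λ l → + (suc μ ∸ l) ℤ.* (bin (α + l) l ℤ.* bin (β + l) l)) ∎
  where
  open ≡-Reasoning
  ring : ∀ x y z → x ℤ.* (y ℤ.* z) ≡ y ℤ.* (z ℤ.* x)
  ring = solve-∀

V-sym : ∀ μ α β → V μ (suc α) β ≡ V μ (suc β) α
V-sym μ α β = trans (V-closed μ α β) (trans
  (∑-cong (suc μ) (λ l _ → cong (+ (suc μ ∸ l) ℤ.*_) (ℤ.*-comm (bin (α + l) l) (bin (β + l) l))))
  (sym (V-closed μ β α)))

bin-1 : ∀ n → bin n 1 ≡ + n
bin-1 zero    = refl
bin-1 (suc n) = cong (ℤ._+_ (+ 1)) (bin-1 n)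

-- Only q = 0 survives: for q > 0 the inner sum is the coefficient of x^q in (1 + x)^(q - 1).
V-0 : ∀ μ β → V μ 0 β ≡ + suc μ
V-0 μ β = begin
  V μ 0 β
    ≡⟨ V-weighted μ 0 β ⟩
  + 1 ℤ.* (bin (suc μ + 0) 1 ℤ.* + 1)
    ℤ.+ ∑ μ (λ q → bin β (suc q) ℤ.* (bin (suc μ + 0) (suc (suc q)) ℤ.* weighted (suc (suc q)) (suc q)))
    ≡⟨ cong₂ ℤ._+_ (trans (ring (bin (suc μ + 0) 1)) (trans (bin-1 (suc μ + 0)) (cong +_ (ℕ.+-identityʳ (suc μ)))))
         (∑-zero μ (λ q _ → begin
           bin β (suc q) ℤ.* (bin (suc μ + 0) (suc (suc q)) ℤ.* weighted (suc (suc q)) (suc q))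
             ≡⟨ cong (λ z → bin β (suc q) ℤ.* (bin (suc μ + 0) (suc (suc q)) ℤ.* z))
                  (trans (weighted≡bin q (suc q)) (n<k⇒bin≡0 (ℕ.n<1+n q))) ⟩
           bin β (suc q) ℤ.* (bin (suc μ + 0) (suc (suc q)) ℤ.* + 0)
             ≡⟨ ring₀ (bin β (suc q)) (bin (suc μ + 0) (suc (suc q))) ⟩
           + 0 ∎)) ⟩
  + suc μ ℤ.+ + 0
    ≡⟨ ℤ.+-identityʳ (+ suc μ) ⟩
  + suc μ ∎
  where
  open ≡-Reasoning
  ring : ∀ x → + 1 ℤ.* (x ℤ.* + 1) ≡ x
  ring = solve-∀
  ring₀ : ∀ x y → x ℤ.* (y ℤ.* + 0) ≡ + 0
  ring₀ = solve-∀

-- That is, G(0, D) = T(D, 0) = 1, multiplied by D = β + 1.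
H-0 : ∀ μ β → H μ 0 β ≡ + suc β
H-0 μ β = *-cancel-fact β (*-cancel-fact (suc μ + 0) (begin
  H μ 0 β ℤ.* fact β ℤ.* fact (suc μ + 0)                 ≡⟨ ℤ.*-assoc (H μ 0 β) (fact β) (fact (suc μ + 0)) ⟩
  H μ 0 β ℤ.* (fact β ℤ.* fact (suc μ + 0))               ≡⟨ H-V μ 0 β ⟩
  V μ 0 β ℤ.* (fact μ ℤ.* fact (suc β))                   ≡⟨ cong₂ (λ x y → x ℤ.* (fact μ ℤ.* y)) (V-0 μ β) (fact-suc β) ⟩
  + suc μ ℤ.* (fact μ ℤ.* (+ suc β ℤ.* fact β))           ≡⟨ ring (+ suc μ) (fact μ) (+ suc β) (fact β) ⟩
  + suc β ℤ.* fact β ℤ.* (+ suc μ ℤ.* fact μ)             ≡⟨ cong (+ suc β ℤ.* fact β ℤ.*_) (trans (sym (fact-suc μ)) (cong fact (sym (ℕ.+-identityʳ (suc μ))))) ⟩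
  + suc β ℤ.* fact β ℤ.* fact (suc μ + 0)                 ∎))
  where
  open ≡-Reasoning
  ring : ∀ x y z w → x ℤ.* (y ℤ.* (z ℤ.* w)) ≡ z ℤ.* w ℤ.* (x ℤ.* y)
  ring = solve-∀

H-sym : ∀ μ α β →
  H μ (suc α) β ℤ.* (fact β ℤ.* fact (suc μ + suc α)) ≡ H μ (suc β) α ℤ.* (fact α ℤ.* fact (suc μ + suc β))
H-sym μ α β = begin
  H μ (suc α) β ℤ.* (fact β ℤ.* fact (suc μ + suc α))    ≡⟨ H-V μ (suc α) β ⟩
  V μ (suc α) β ℤ.* (fact μ ℤ.* fact (suc α + suc β))    ≡⟨ cong₂ (λ x y → x ℤ.* (fact μ ℤ.* fact y)) (V-sym μ α β) (ℕ.+-comm (suc α) (suc β)) ⟩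
  V μ (suc β) α ℤ.* (fact μ ℤ.* fact (suc β + suc α))    ≡⟨ H-V μ (suc β) α ⟨
  H μ (suc β) α ℤ.* (fact α ℤ.* fact (suc μ + suc β))    ∎
  where open ≡-Reasoning

-- Solving the recurrence

T⇒≡true : ∀ {b} → T b → b ≡ true
T⇒≡true {true} _ = refl

¬T⇒≡false : ∀ {b} → ¬ T b → b ≡ false
¬T⇒≡false {false} _  = refl
¬T⇒≡false {true}  ¬t = contradiction _ ¬t

revP-≤ : ∀ D q {x} → x ≤ D → revP D q x ≡ q (D ∸ x)
revP-≤ D q {x} x≤D = cong (λ b → if b then q (D ∸ x) else + 0) (T⇒≡true (ℕ.≤⇒≤ᵇ x≤D))

revP-> : ∀ D q {x} → D < x → revP D q x ≡ + 0
revP-> D q {x} D<x = cong (λ b → if b then q (D ∸ x) else + 0) (¬T⇒≡false (λ t → ℕ.<⇒≱ D<x (ℕ.≤ᵇ⇒≤ x D t)))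

multinomial-outer : ∀ m s p D →
  bin (m + (D + (s + p))) s ℤ.* bin (D + (m + p)) D ℤ.* (fact s ℤ.* (fact D ℤ.* fact (m + p))) ≡ fact (m + (D + (s + p)))
multinomial-outer m s p D = begin
  bin n s ℤ.* bin (D + (m + p)) D ℤ.* (fact s ℤ.* (fact D ℤ.* fact (m + p)))
    ≡⟨ ring (bin n s) (bin (D + (m + p)) D) (fact s) (fact D ℤ.* fact (m + p)) ⟩
  bin n s ℤ.* (fact s ℤ.* (bin (D + (m + p)) D ℤ.* (fact D ℤ.* fact (m + p))))
    ≡⟨ cong (λ z → bin n s ℤ.* (fact s ℤ.* z)) (bin-fact D (m + p)) ⟩
  bin n s ℤ.* (fact s ℤ.* fact (D + (m + p)))
    ≡⟨ bin-fact′ s (D + (m + p)) (index m s p D) ⟩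
  fact n ∎
  where
  open ≡-Reasoning
  n : ℕ
  n = m + (D + (s + p))
  index : ∀ m s p D → m + (D + (s + p)) ≡ s + (D + (m + p))
  index = ℕ-Solver.solve-∀
  ring : ∀ a b c d → a ℤ.* b ℤ.* (c ℤ.* d) ≡ a ℤ.* (c ℤ.* (b ℤ.* d))
  ring = solve-∀

-- Both sides are n! / (x! s! i! (m + p)!) with n = m + i + x + s + p. For fixed D = i + x the right
-- side depends on `i` only through C(D, i), the kernel of the transform G(D, p).
multinomial-inner : ∀ m s p i x →
  bin (m + (i + x + (s + p))) (x + s) ℤ.* (bin (x + s) s ℤ.* bin (m + (p + i)) i) ≡
  bin (m + (i + x + (s + p))) s ℤ.* bin (i + x + (m + p)) (i + x) ℤ.* bin (i + x) i
multinomial-inner m s p i x = *-cancel-fact x (*-cancel-fact s (*-cancel-fact i (*-cancel-fact (m + p) (begin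
  A ℤ.* (B ℤ.* G) ℤ.* fact x ℤ.* fact s ℤ.* fact i ℤ.* fact (m + p)
    ≡⟨ ring₁ A B G (fact x) (fact s) (fact i) (fact (m + p)) ⟩
  A ℤ.* ((B ℤ.* (fact s ℤ.* fact x)) ℤ.* (G ℤ.* (fact i ℤ.* fact (m + p))))
    ≡⟨ cong₂ (λ u v → A ℤ.* (u ℤ.* v)) (bin-fact′ s x (ℕ.+-comm x s)) (bin-fact′ i (m + p) (index₁ m p i)) ⟩
  A ℤ.* (fact (x + s) ℤ.* fact (m + (p + i)))
    ≡⟨ bin-fact′ (x + s) (m + (p + i)) (index₂ m s p i x) ⟩
  fact n
    ≡⟨ multinomial-outer m s p (i + x) ⟨
  E ℤ.* F ℤ.* (fact s ℤ.* (fact (i + x) ℤ.* fact (m + p)))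
    ≡⟨ cong (λ z → E ℤ.* F ℤ.* (fact s ℤ.* (z ℤ.* fact (m + p)))) (bin-fact i x) ⟨
  E ℤ.* F ℤ.* (fact s ℤ.* ((K ℤ.* (fact i ℤ.* fact x)) ℤ.* fact (m + p)))
    ≡⟨ ring₂ E F K (fact x) (fact s) (fact i) (fact (m + p)) ⟩
  E ℤ.* F ℤ.* K ℤ.* fact x ℤ.* fact s ℤ.* fact i ℤ.* fact (m + p) ∎))))
  where
  open ≡-Reasoning
  n : ℕ
  n = m + (i + x + (s + p))
  A B E F G K : ℤ
  A = bin n (x + s)
  B = bin (x + s) s
  G = bin (m + (p + i)) i
  E = bin n s
  F = bin (i + x + (m + p)) (i + x)
  K = bin (i + x) i
  index₁ : ∀ m p i → m + (p + i) ≡ i + (m + p)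
  index₁ = ℕ-Solver.solve-∀
  index₂ : ∀ m s p i x → m + (i + x + (s + p)) ≡ x + s + (m + (p + i))
  index₂ = ℕ-Solver.solve-∀
  ring₁ : ∀ A B G x s i f → A ℤ.* (B ℤ.* G) ℤ.* x ℤ.* s ℤ.* i ℤ.* f ≡ A ℤ.* ((B ℤ.* (s ℤ.* x)) ℤ.* (G ℤ.* (i ℤ.* f)))
  ring₁ = solve-∀
  ring₂ : ∀ E F K x s i f → E ℤ.* F ℤ.* (s ℤ.* ((K ℤ.* (i ℤ.* x)) ℤ.* f)) ≡ E ℤ.* F ℤ.* K ℤ.* x ℤ.* s ℤ.* i ℤ.* f
  ring₂ = solve-∀

-- Divided by D p, where D = β + 1, p = α + 1 and k = s + p, this reads C(n, s) C(D + m + p, D) G(D,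
-- p) = C(n, k) C(k, s) G(p, D). It is the symmetry of G with the factorials traded for the binomial
-- coefficients of the recurrence; up to sign, the right side is C(n, k) times a summand of the k-th
-- difference.
H-exchange : ∀ μ s α β → let n = suc μ + (suc β + (s + suc α)) in
  + suc β ℤ.* (bin n s ℤ.* bin (suc β + (suc μ + suc α)) (suc β) ℤ.* H μ (suc β) α) ≡
  + suc α ℤ.* (bin n (s + suc α) ℤ.* bin (s + suc α) s ℤ.* H μ (suc α) β)
H-exchange μ s α β =
  *-cancel-fact s (*-cancel-fact α (*-cancel-fact (m + D) (*-cancel-fact β (*-cancel-fact (m + p) (begin
  + D ℤ.* (E ℤ.* F ℤ.* H₁) ℤ.* fact s ℤ.* fact α ℤ.* fact (m + D) ℤ.* fact β ℤ.* fact (m + p)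
    ≡⟨ ring₁ (+ D) (E ℤ.* F) H₁ (fact s) (fact α) (fact (m + D)) (fact β) (fact (m + p)) ⟩
  (E ℤ.* F ℤ.* (fact s ℤ.* ((+ D ℤ.* fact β) ℤ.* fact (m + p)))) ℤ.* (H₁ ℤ.* (fact α ℤ.* fact (m + D)))
    ≡⟨ cong₂ ℤ._*_
         (trans (cong (λ z → E ℤ.* F ℤ.* (fact s ℤ.* (z ℤ.* fact (m + p)))) (sym (fact-suc β))) (multinomial-outer m s p D))
         (H-sym μ β α) ⟩
  fact n ℤ.* (H₂ ℤ.* (fact β ℤ.* fact (m + p)))
    ≡⟨ cong (ℤ._* (H₂ ℤ.* (fact β ℤ.* fact (m + p)))) (begin
         fact n
           ≡⟨ bin-fact′ (s + p) (m + D) (index m D (s + p)) ⟨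
         A ℤ.* (fact (s + p) ℤ.* fact (m + D))
           ≡⟨ cong (λ z → A ℤ.* (z ℤ.* fact (m + D))) (bin-fact s p) ⟨
         A ℤ.* ((B ℤ.* (fact s ℤ.* fact p)) ℤ.* fact (m + D))
           ≡⟨ cong (λ z → A ℤ.* ((B ℤ.* (fact s ℤ.* z)) ℤ.* fact (m + D))) (fact-suc α) ⟩
         A ℤ.* ((B ℤ.* (fact s ℤ.* (+ p ℤ.* fact α))) ℤ.* fact (m + D)) ∎) ⟩
  A ℤ.* ((B ℤ.* (fact s ℤ.* (+ p ℤ.* fact α))) ℤ.* fact (m + D)) ℤ.* (H₂ ℤ.* (fact β ℤ.* fact (m + p)))
    ≡⟨ ring₂ (+ p) A B H₂ (fact s) (fact α) (fact (m + D)) (fact β) (fact (m + p)) ⟩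
  + p ℤ.* (A ℤ.* B ℤ.* H₂) ℤ.* fact s ℤ.* fact α ℤ.* fact (m + D) ℤ.* fact β ℤ.* fact (m + p) ∎)))))
  where
  open ≡-Reasoning
  m D p n : ℕ
  m = suc μ
  D = suc β
  p = suc α
  n = m + (D + (s + p))
  A B E F H₁ H₂ : ℤ
  A = bin n (s + p)
  B = bin (s + p) s
  E = bin n s
  F = bin (D + (m + p)) D
  H₁ = H μ D α
  H₂ = H μ p β
  index : ∀ m D k → m + (D + k) ≡ k + (m + D)
  index = ℕ-Solver.solve-∀
  ring₁ : ∀ D EF H s a mD b mp → D ℤ.* (EF ℤ.* H) ℤ.* s ℤ.* a ℤ.* mD ℤ.* b ℤ.* mp ≡ (EF ℤ.* (s ℤ.* ((D ℤ.* b) ℤ.* mp))) ℤ.* (H ℤ.* (a ℤ.* mD))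
  ring₁ = solve-∀
  ring₂ : ∀ p A B H s a mD b mp → A ℤ.* ((B ℤ.* (s ℤ.* (p ℤ.* a))) ℤ.* mD) ℤ.* (H ℤ.* (b ℤ.* mp)) ≡ p ℤ.* (A ℤ.* B ℤ.* H) ℤ.* s ℤ.* a ℤ.* mD ℤ.* b ℤ.* mp
  ring₂ = solve-∀

-- The contribution of the C(n, j) flats of size j to the coefficient of t^D. The characteristic
-- polynomial (t - 1)^j has coefficient (-1)^s C(j, s) at t^(j-s); `revP` then picks the coefficient
-- at D - (j - s), and gives 0 where this is negative instead of letting the subtraction truncate.
klTerm : (ℕ → ℕ → ℤ) → ℕ → ℕ → ℕ → ℕ → ℤ
klTerm c n d D j = bin n j ℤ.* binSum j (λ s → sgn s ℤ.* revP D (c (d ∸ j)) (j ∸ s))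

column : (ℕ → ℕ → ℤ) → ℕ → ℕ → ℕ → ℕ → ℕ → ℤ
column c n d D s j = bin n j ℤ.* (bin j s ℤ.* revP D (c (d ∸ j)) (j ∸ s))

∑-klTerm : ∀ c n d D → ∑ d (klTerm c n d D) ≡ ∑ d (λ s → sgn s ℤ.* ∑ d (column c n d D s))
∑-klTerm c n d D = begin
  ∑ d (klTerm c n d D)
    ≡⟨ ∑-cong d (λ j j<d → cong (bin n j ℤ.*_) (trans
         (sym (binSum-extend j<d (λ s → sgn s ℤ.* revP D (c (d ∸ j)) (j ∸ s))))
         (∑-cong d (λ s _ → ring (bin j s) (sgn s) (revP D (c (d ∸ j)) (j ∸ s)))))) ⟩
  ∑ d (λ j → bin n j ℤ.* ∑ d (λ s → sgn s ℤ.* (bin j s ℤ.* revP D (c (d ∸ j)) (j ∸ s))))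
    ≡⟨ ∑-*-∑ d d sgn (bin n) (λ s j → bin j s ℤ.* revP D (c (d ∸ j)) (j ∸ s)) ⟩
  ∑ d (λ s → sgn s ℤ.* ∑ d (column c n d D s)) ∎
  where
  open ≡-Reasoning
  ring : ∀ x y z → x ℤ.* (y ℤ.* z) ≡ y ℤ.* (x ℤ.* z)
  ring = solve-∀

-- For s ≥ k the degree D - j + s is at least D + k - j, the full rank of the contraction, and so
-- lies above the degree bound.
column-high : ∀ c n D k s j → (∀ e i → 0 < e → e ≤ 2 ℕ.* i → c e i ≡ + 0) →
  k ≤ s → j < D + k → column c n (D + k) D s j ≡ + 0
column-high c n D k s j vanish k≤s j<d with s ℕ.≤? j
... | no s≰j = trans (cong (λ z → bin n j ℤ.* (z ℤ.* revP D (c (D + k ∸ j)) (j ∸ s))) (n<k⇒bin≡0 (ℕ.≰⇒> s≰j))) (ℤ.*-zeroʳ (bin n j))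
... | yes s≤j = trans (cong (λ z → bin n j ℤ.* (bin j s ℤ.* z))
    (trans (revP-≤ D (c (D + k ∸ j)) j∸s≤D) (vanish (D + k ∸ j) (D ∸ (j ∸ s)) (ℕ.m<n⇒0<n∸m j<d) (ℕ.≤-trans bound (ℕ.m≤m+n _ _)))))
    (ring (bin n j) (bin j s))
  where
  ring : ∀ x y → x ℤ.* (y ℤ.* + 0) ≡ + 0
  ring = solve-∀
  j∸s≤D : j ∸ s ≤ D
  j∸s≤D = ℕ.m≤n+o⇒m∸n≤o j s (ℕ.≤-trans (ℕ.<⇒≤ j<d) (ℕ.≤-trans (ℕ.+-monoʳ-≤ D k≤s) (ℕ.≤-reflexive (ℕ.+-comm D s))))
  bound : D + k ∸ j ≤ D ∸ (j ∸ s)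
  bound = ℕ.≤-trans (ℕ.∸-monoˡ-≤ j (ℕ.+-monoʳ-≤ D k≤s)) (ℕ.≤-reflexive
    (trans (cong (D + s ∸_) (sym (ℕ.m+[n∸m]≡n s≤j))) (trans (cong (_∸ (s + (j ∸ s))) (ℕ.+-comm D s)) (ℕ.[m+n]∸[m+o]≡n∸o s D (j ∸ s)))))

-- The substitution j = D + s - i turns the entries into c_{m,p+i}^i, to which `hc` applies with one
-- fixed `α`. What lies outside 0 ≤ i ≤ D vanishes: j > D + s asks for a negative degree, and j < s
-- makes C(j, s) zero. The sum over i is then G(D, p), and `H-exchange` swaps its arguments.
∑-column : ∀ μ s α β c → let p = suc α; D = suc β; k = s + p; n = suc μ + (D + k) in
  (∀ i → + p ℤ.* c (p + i) i ≡ bin (suc μ + (p + i)) i ℤ.* U μ α i) →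
  + D ℤ.* ∑ (D + k) (column c n (D + k) D s) ≡ bin n k ℤ.* bin k s ℤ.* H μ p β
∑-column μ s α β c hc = ℤ.*-cancelˡ-≡ (+ p) (+ D ℤ.* S) (bin n k ℤ.* bin k s ℤ.* H μ p β) (begin
  + p ℤ.* (+ D ℤ.* S)                                     ≡⟨ ring (+ p) (+ D) S ⟩
  + D ℤ.* (+ p ℤ.* S)                                     ≡⟨ cong (+ D ℤ.*_) p*S ⟩
  + D ℤ.* (M ℤ.* H μ D α)                                 ≡⟨ H-exchange μ s α β ⟩
  + p ℤ.* (bin n k ℤ.* bin k s ℤ.* H μ p β)               ∎)
  where
  open ≡-Reasoning
  p D k d n : ℕ
  p = suc α
  D = suc β
  k = s + p
  d = D + k
  n = suc μ + d
  S M : ℤ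
  S = ∑ d (column c n d D s)
  M = bin n s ℤ.* bin (D + (suc μ + p)) D
  ring : ∀ x y z → x ℤ.* (y ℤ.* z) ≡ y ℤ.* (x ℤ.* z)
  ring = solve-∀

  d≡ : d ≡ suc (D + s) + α
  d≡ = index D s α
    where
    index : ∀ D s α → D + (s + suc α) ≡ suc (D + s) + α
    index = ℕ-Solver.solve-∀

  zero-term : ∀ x u → x ℤ.* (u ℤ.* + 0) ≡ + 0
  zero-term = solve-∀

  beyond : ∀ j → D + s < j → column c n d D s j ≡ + 0
  beyond j D+s<j = trans
    (cong (λ z → bin n j ℤ.* (bin j s ℤ.* z)) (revP-> D (c (d ∸ j)) (ℕ.m+n≤o⇒m≤o∸n (suc D) D+s<j)))
    (zero-term (bin n j) (bin j s))

  term : ∀ i → i ≤ D + s → + p ℤ.* column c n d D s (D + s ∸ i) ≡ M ℤ.* (bin D i ℤ.* U μ α i)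
  term i i≤D+s with i ℕ.≤? D
  ... | no i≰D = begin
    + p ℤ.* column c n d D s j
      ≡⟨ cong (λ z → + p ℤ.* (bin n j ℤ.* (z ℤ.* revP D (c (d ∸ j)) (j ∸ s)))) (n<k⇒bin≡0 j<s) ⟩
    + p ℤ.* (bin n j ℤ.* + 0)
      ≡⟨ zero-term (+ p) (bin n j) ⟩
    + 0
      ≡⟨ ℤ.*-zeroʳ M ⟨
    M ℤ.* + 0
      ≡⟨ cong (λ z → M ℤ.* (z ℤ.* U μ α i)) (n<k⇒bin≡0 (ℕ.≰⇒> i≰D)) ⟨
    M ℤ.* (bin D i ℤ.* U μ α i) ∎
    where
    j : ℕ
    j = D + s ∸ i
    j<s : j < s
    j<s = ℕ.<-≤-trans (ℕ.∸-monoʳ-< (ℕ.≰⇒> i≰D) i≤D+s) (ℕ.≤-reflexive (ℕ.m+n∸m≡n D s))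
  ... | yes i≤D = begin
    + p ℤ.* column c n d D s (D + s ∸ i)
      ≡⟨ cong (λ z → + p ℤ.* column c n d D s z) j≡ ⟩
    + p ℤ.* (bin n (x + s) ℤ.* (bin (x + s) s ℤ.* revP D (c (d ∸ (x + s))) (x + s ∸ s)))
      ≡⟨ cong (λ z → + p ℤ.* (bin n (x + s) ℤ.* (bin (x + s) s ℤ.* z))) value ⟩
    + p ℤ.* (bin n (x + s) ℤ.* (bin (x + s) s ℤ.* c (p + i) i))
      ≡⟨ ring₁ (+ p) (bin n (x + s)) (bin (x + s) s) (c (p + i) i) ⟩
    bin n (x + s) ℤ.* (bin (x + s) s ℤ.* (+ p ℤ.* c (p + i) i))
      ≡⟨ cong (λ z → bin n (x + s) ℤ.* (bin (x + s) s ℤ.* z)) (hc i) ⟩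
    bin n (x + s) ℤ.* (bin (x + s) s ℤ.* (bin (suc μ + (p + i)) i ℤ.* U μ α i))
      ≡⟨ ring₂ (bin n (x + s)) (bin (x + s) s) (bin (suc μ + (p + i)) i) (U μ α i) ⟩
    bin n (x + s) ℤ.* (bin (x + s) s ℤ.* bin (suc μ + (p + i)) i) ℤ.* U μ α i
      ≡⟨ cong (ℤ._* U μ α i) (subst (λ z →
           bin (suc μ + (z + k)) (x + s) ℤ.* (bin (x + s) s ℤ.* bin (suc μ + (p + i)) i) ≡
           bin (suc μ + (z + k)) s ℤ.* bin (z + (suc μ + p)) z ℤ.* bin z i)
           (ℕ.m+[n∸m]≡n i≤D) (multinomial-inner (suc μ) s p i x)) ⟩
    M ℤ.* bin D i ℤ.* U μ α i
      ≡⟨ ℤ.*-assoc M (bin D i) (U μ α i) ⟩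
    M ℤ.* (bin D i ℤ.* U μ α i) ∎
    where
    x : ℕ
    x = D ∸ i
    j≡ : D + s ∸ i ≡ x + s
    j≡ = trans (cong (_∸ i) (ℕ.+-comm D s)) (trans (ℕ.+-∸-assoc s i≤D) (ℕ.+-comm s x))
    d∸j : d ∸ (x + s) ≡ p + i
    d∸j = trans (cong (_∸ (x + s)) (trans (cong (_+ k) (sym (ℕ.m+[n∸m]≡n i≤D))) (index i x s p))) (ℕ.m+n∸m≡n (x + s) (p + i))
      where
      index : ∀ i x s p → i + x + (s + p) ≡ x + s + (p + i)
      index = ℕ-Solver.solve-∀
    value : revP D (c (d ∸ (x + s))) (x + s ∸ s) ≡ c (p + i) i
    value = begin
      revP D (c (d ∸ (x + s))) (x + s ∸ s)   ≡⟨ cong₂ (λ e y → revP D (c e) y) d∸j (ℕ.m+n∸n≡m x s) ⟩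
      revP D (c (p + i)) x                   ≡⟨ revP-≤ D (c (p + i)) (ℕ.m∸n≤m D i) ⟩
      c (p + i) (D ∸ (D ∸ i))                ≡⟨ cong (c (p + i)) (ℕ.m∸[m∸n]≡n i≤D) ⟩
      c (p + i) i                            ∎
    ring₁ : ∀ p x y z → p ℤ.* (x ℤ.* (y ℤ.* z)) ≡ x ℤ.* (y ℤ.* (p ℤ.* z))
    ring₁ = solve-∀
    ring₂ : ∀ x y z w → x ℤ.* (y ℤ.* (z ℤ.* w)) ≡ x ℤ.* (y ℤ.* z) ℤ.* w
    ring₂ = solve-∀

  p*S : + p ℤ.* S ≡ M ℤ.* H μ D α
  p*S = begin
    + p ℤ.* S
      ≡⟨ cong (+ p ℤ.*_) (trans (∑-extend (subst (suc (D + s) ≤_) (sym d≡) (ℕ.m≤m+n _ α)) (column c n d D s) (λ j le _ → beyond j le))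
           (∑-reverse (D + s) (column c n d D s))) ⟩
    + p ℤ.* ∑ (suc (D + s)) (λ i → column c n d D s (D + s ∸ i))
      ≡⟨ *-∑ (suc (D + s)) (+ p) (λ i → column c n d D s (D + s ∸ i)) ⟩
    ∑ (suc (D + s)) (λ i → + p ℤ.* column c n d D s (D + s ∸ i))
      ≡⟨ ∑-cong (suc (D + s)) (λ i i<d → term i (ℕ.≤-pred i<d)) ⟩
    ∑ (suc (D + s)) (λ i → M ℤ.* (bin D i ℤ.* U μ α i))
      ≡⟨ *-∑ (suc (D + s)) M (λ i → bin D i ℤ.* U μ α i) ⟨
    M ℤ.* ∑ (suc (D + s)) (λ i → bin D i ℤ.* U μ α i)
      ≡⟨ cong (M ℤ.*_) (∑-bin-U μ α (s≤s (ℕ.m≤m+n D s))) ⟩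
    M ℤ.* H μ D α ∎

recurrence-solution : ∀ μ β k c → let D = suc β; n = suc μ + (D + k) in
  (∀ e i → 0 < e → e ≤ 2 ℕ.* i → c e i ≡ + 0) →
  (∀ α → suc α ≤ k → ∀ i → + suc α ℤ.* c (suc α + i) i ≡ bin (suc μ + (suc α + i)) i ℤ.* U μ α i) →
  + D ℤ.* (∑ (D + k) (klTerm c n (D + k) D) ℤ.+ sgn k ℤ.* bin n k) ≡ bin n k ℤ.* U μ β k
recurrence-solution μ β k c vanish hc = begin
  + D ℤ.* (∑ d (klTerm c n d D) ℤ.+ sgn k ℤ.* N)
    -- The degree bound removes the columns s ≥ k, where k - s would no longer be positive.
    ≡⟨ cong (λ z → + D ℤ.* (z ℤ.+ sgn k ℤ.* N)) (trans (∑-klTerm c n d D) (∑-extend (ℕ.m≤n+m k D) (λ s → sgn s ℤ.* col s) high)) ⟩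
  + D ℤ.* (∑ k (λ s → sgn s ℤ.* col s) ℤ.+ sgn k ℤ.* N)
    ≡⟨ trans (ℤ.*-distribˡ-+ (+ D) (∑ k (λ s → sgn s ℤ.* col s)) (sgn k ℤ.* N)) (cong (ℤ._+ (+ D ℤ.* (sgn k ℤ.* N))) (*-∑ k (+ D) (λ s → sgn s ℤ.* col s))) ⟩
  ∑ k (λ s → + D ℤ.* (sgn s ℤ.* col s)) ℤ.+ + D ℤ.* (sgn k ℤ.* N)
    -- The columns give the summands s < k of the difference. The term of the ground set is the
    -- missing one at s = k, since G(0, D) = 1.
    ≡⟨ cong₂ ℤ._+_ (∑-cong k low) last ⟩
  ∑ k (λ s → N ℤ.* summand s) ℤ.+ N ℤ.* summand k
    ≡⟨ ∑-last k (λ s → N ℤ.* summand s) ⟨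
  ∑ (suc k) (λ s → N ℤ.* summand s)
    ≡⟨ *-∑ (suc k) N summand ⟨
  N ℤ.* difference k (λ p → H μ p β)
    ≡⟨ cong (N ℤ.*_) (difference-H μ β k) ⟩
  N ℤ.* U μ β k ∎
  where
  open ≡-Reasoning
  D d n : ℕ
  D = suc β
  d = D + k
  n = suc μ + d
  N : ℤ
  N = bin n k
  col summand : ℕ → ℤ
  col s = ∑ d (column c n d D s)
  summand s = bin k s ℤ.* (sgn s ℤ.* H μ (k ∸ s) β)

  high : ∀ s → k ≤ s → s < d → sgn s ℤ.* col s ≡ + 0
  high s k≤s _ = trans (cong (sgn s ℤ.*_) (∑-zero d (λ j j<d → column-high c n D k s j vanish k≤s j<d))) (ℤ.*-zeroʳ (sgn s))

  ring : ∀ x y z → x ℤ.* (y ℤ.* z) ≡ y ℤ.* (x ℤ.* z)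
  ring = solve-∀
  ring₁ : ∀ s N b H → s ℤ.* (N ℤ.* b ℤ.* H) ≡ N ℤ.* (b ℤ.* (s ℤ.* H))
  ring₁ = solve-∀
  ring₂ : ∀ D s N → D ℤ.* (s ℤ.* N) ≡ N ℤ.* (+ 1 ℤ.* (s ℤ.* D))
  ring₂ = solve-∀

  col-value : ∀ s → s < k → + D ℤ.* col s ≡ N ℤ.* bin k s ℤ.* H μ (k ∸ s) β
  col-value s s<k with ℕ.m≤n⇒∃[o]m+o≡n s<k
  ... | α , eq = subst
    (λ z → + D ℤ.* ∑ (D + z) (column c (suc μ + (D + z)) (D + z) D s) ≡ bin (suc μ + (D + z)) z ℤ.* bin z s ℤ.* H μ (z ∸ s) β)
    k≡
    (trans (∑-column μ s α β c (hc α (subst (suc α ≤_) k≡ (ℕ.m≤n+m (suc α) s))))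
           (cong (λ z → bin (suc μ + (D + (s + suc α))) (s + suc α) ℤ.* bin (s + suc α) s ℤ.* H μ z β) (sym (ℕ.m+n∸m≡n s (suc α)))))
    where
    k≡ : s + suc α ≡ k
    k≡ = trans (ℕ.+-suc s α) eq

  low : ∀ s → s < k → + D ℤ.* (sgn s ℤ.* col s) ≡ N ℤ.* summand s
  low s s<k = begin
    + D ℤ.* (sgn s ℤ.* col s)                        ≡⟨ ring (+ D) (sgn s) (col s) ⟩
    sgn s ℤ.* (+ D ℤ.* col s)                        ≡⟨ cong (sgn s ℤ.*_) (col-value s s<k) ⟩
    sgn s ℤ.* (N ℤ.* bin k s ℤ.* H μ (k ∸ s) β)      ≡⟨ ring₁ (sgn s) N (bin k s) (H μ (k ∸ s) β) ⟩
    N ℤ.* summand s                                  ∎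

  last : + D ℤ.* (sgn k ℤ.* N) ≡ N ℤ.* summand k
  last = begin
    + D ℤ.* (sgn k ℤ.* N)                            ≡⟨ ring₂ (+ D) (sgn k) N ⟩
    N ℤ.* (+ 1 ℤ.* (sgn k ℤ.* + D))                  ≡⟨ cong₂ (λ x y → N ℤ.* (x ℤ.* (sgn k ℤ.* y))) (bin-nn k) (trans (cong (λ z → H μ z β) (ℕ.n∸n≡0 k)) (H-0 μ β)) ⟨
    N ℤ.* summand k                                  ∎

-- Sums over subsets and flats of a uniform matroid

sumℤ-++ : ∀ xs ys → sumℤ (xs ++ ys) ≡ sumℤ xs ℤ.+ sumℤ ys
sumℤ-++ []       ys = sym (ℤ.+-identityˡ (sumℤ ys))
sumℤ-++ (x ∷ xs) ys = trans (cong (ℤ._+_ x) (sumℤ-++ xs ys)) (sym (ℤ.+-assoc x (sumℤ xs) (sumℤ ys)))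

sumℤ-map-cong : ∀ {A : Set} {f g : A → ℤ} → (∀ x → f x ≡ g x) → ∀ xs → sumℤ (map f xs) ≡ sumℤ (map g xs)
sumℤ-map-cong f≡g xs = cong sumℤ (List.map-cong f≡g xs)

sumℤ-map-zero : ∀ {A : Set} (xs : List A) → sumℤ (map (λ _ → + 0) xs) ≡ + 0
sumℤ-map-zero []       = refl
sumℤ-map-zero (x ∷ xs) = trans (ℤ.+-identityˡ (sumℤ (map (λ _ → + 0) xs))) (sumℤ-map-zero xs)

sumℤ-filterᵇ : ∀ {A : Set} (p : A → Bool) (f : A → ℤ) xs →
  sumℤ (map f (List.filterᵇ p xs)) ≡ sumℤ (map (λ x → if p x then f x else + 0) xs)
sumℤ-filterᵇ p f []       = refl
sumℤ-filterᵇ p f (x ∷ xs) with p x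
... | true  = cong (ℤ._+_ (f x)) (sumℤ-filterᵇ p f xs)
... | false = trans (sumℤ-filterᵇ p f xs) (sym (ℤ.+-identityˡ (sumℤ (map (λ x → if p x then f x else + 0) xs))))

sumℤ-upTo : ∀ n f → sumℤ (map f (upTo n)) ≡ ∑ n f
sumℤ-upTo n f = trans (cong sumℤ (List.map-upTo f n)) (go n f)
  where
  go : ∀ n f → sumℤ (applyUpTo f n) ≡ ∑ n f
  go zero    f = refl
  go (suc n) f = cong (ℤ._+_ (f 0)) (go n (λ i → f (suc i)))

sumP-map : ∀ {A : Set} (g : A → Poly) xs k → sumP (map g xs) k ≡ sumℤ (map (λ x → g x k) xs)
sumP-map g []       k = refl
sumP-map g (x ∷ xs) k = cong (ℤ._+_ (g x k)) (sumP-map g xs k)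

∑-single : ∀ {n k} f → k < n → (∀ i → i ≢ k → f i ≡ + 0) → ∑ n f ≡ f k
∑-single {suc n} {zero} f _ f≡0 =
  trans (cong (ℤ._+_ (f 0)) (∑-zero n (λ i _ → f≡0 (suc i) (λ ())))) (ℤ.+-identityʳ (f 0))
∑-single {suc n} {suc k} f (s≤s k<n) f≡0 = trans
  (cong₂ ℤ._+_ (f≡0 0 (λ ())) (∑-single (λ i → f (suc i)) k<n (λ i i≢k → f≡0 (suc i) (λ eq → i≢k (ℕ.suc-injective eq)))))
  (ℤ.+-identityˡ (f (suc k)))

n≡ᵇn : ∀ n → (n ≡ᵇ n) ≡ true
n≡ᵇn n = T⇒≡true (ℕ.≡⇒≡ᵇ n n refl)

≢⇒≡ᵇ≡false : ∀ {m n} → m ≢ n → (m ≡ᵇ n) ≡ false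
≢⇒≡ᵇ≡false {m} {n} m≢n = ¬T⇒≡false (λ t → m≢n (ℕ.≡ᵇ⇒≡ m n t))

-- The coefficient of t^D in the product of the monomial v t^x with `q`; for x > D both sides are 0.
∑-delta : ∀ D x v (q : ℕ → ℤ) → ∑ (suc D) (λ j → (if x ≡ᵇ j then v else + 0) ℤ.* q (D ∸ j)) ≡ v ℤ.* revP D q x
∑-delta D x v q with x ℕ.≤? D
... | yes x≤D = begin
  ∑ (suc D) f            ≡⟨ ∑-single f (s≤s x≤D) (λ j j≢x → off j (λ eq → j≢x (sym eq))) ⟩
  f x                    ≡⟨ cong (λ b → (if b then v else + 0) ℤ.* q (D ∸ x)) (n≡ᵇn x) ⟩
  v ℤ.* q (D ∸ x)        ≡⟨ cong (v ℤ.*_) (revP-≤ D q x≤D) ⟨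
  v ℤ.* revP D q x       ∎
  where
  open ≡-Reasoning
  f : ℕ → ℤ
  f j = (if x ≡ᵇ j then v else + 0) ℤ.* q (D ∸ j)
  off : ∀ j → x ≢ j → f j ≡ + 0
  off j x≢j = cong (λ b → (if b then v else + 0) ℤ.* q (D ∸ j)) (≢⇒≡ᵇ≡false x≢j)
... | no x≰D = trans
  (∑-zero (suc D) (λ j j≤D → cong (λ b → (if b then v else + 0) ℤ.* q (D ∸ j))
     (≢⇒≡ᵇ≡false (λ x≡j → x≰D (subst (_≤ D) (sym x≡j) (ℕ.≤-pred j≤D))))))
  (sym (trans (cong (v ℤ.*_) (revP-> D q (ℕ.≰⇒> x≰D))) (ℤ.*-zeroʳ v)))

-- Finite subsets and their cardinalities

⊆ᵇ⇒⊆ : ∀ {n} (A B : Subset n) → T (A ⊆ᵇ B) → A ⊆ B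
⊆ᵇ⇒⊆ (outside ∷ A) (y ∷ B)      t = out⊆ (⊆ᵇ⇒⊆ A B t)
⊆ᵇ⇒⊆ (inside ∷ A)  (inside ∷ B) t = s⊆s (⊆ᵇ⇒⊆ A B t)

⊆⇒⊆ᵇ : ∀ {n} (A B : Subset n) → A ⊆ B → (A ⊆ᵇ B) ≡ true
⊆⇒⊆ᵇ []            []            _   = refl
⊆⇒⊆ᵇ (outside ∷ A) (y ∷ B)       A⊆B = ⊆⇒⊆ᵇ A B (drop-∷-⊆ A⊆B)
⊆⇒⊆ᵇ (inside ∷ A)  (inside ∷ B)  A⊆B = ⊆⇒⊆ᵇ A B (drop-∷-⊆ A⊆B)
⊆⇒⊆ᵇ (inside ∷ A)  (outside ∷ B) A⊆B = contradiction (A⊆B Vec.here) λ ()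

∈ᵇ-true : ∀ {n} {e : Fin n} {A} → e ∈ A → (e ∈ᵇ A) ≡ true
∈ᵇ-true = []=⇒lookup

∈ᵇ-false : ∀ {n} {e : Fin n} {A} → e ∉ A → (e ∈ᵇ A) ≡ false
∈ᵇ-false {e = e} {A} e∉A with lookup A e in eq
... | true  = contradiction (lookup⇒[]= e A eq) e∉A
... | false = refl

∣p∪q∣+∣p∩q∣ : ∀ {n} (p q : Subset n) → ∣ p ∪ q ∣ + ∣ p ∩ q ∣ ≡ ∣ p ∣ + ∣ q ∣
∣p∪q∣+∣p∩q∣ []            []            = refl
∣p∪q∣+∣p∩q∣ (outside ∷ p) (outside ∷ q) = ∣p∪q∣+∣p∩q∣ p q
∣p∪q∣+∣p∩q∣ (outside ∷ p) (inside ∷ q)  = trans (cong suc (∣p∪q∣+∣p∩q∣ p q)) (sym (ℕ.+-suc (∣ p ∣) ∣ q ∣))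
∣p∪q∣+∣p∩q∣ (inside ∷ p)  (outside ∷ q) = cong suc (∣p∪q∣+∣p∩q∣ p q)
∣p∪q∣+∣p∩q∣ (inside ∷ p)  (inside ∷ q)  = cong suc (trans (ℕ.+-suc (∣ p ∪ q ∣) ∣ p ∩ q ∣)
  (trans (cong suc (∣p∪q∣+∣p∩q∣ p q)) (sym (ℕ.+-suc (∣ p ∣) ∣ q ∣))))

x∈p─q⇒x∉q : ∀ {n} (p q : Subset n) {x} → x ∈ p ─ q → x ∉ q
x∈p─q⇒x∉q (_ ∷ p) (outside ∷ q) (Vec.there x∈) (Vec.there x∈q) = x∈p─q⇒x∉q p q x∈ x∈q
x∈p─q⇒x∉q (_ ∷ p) (inside ∷ q)  (Vec.there x∈) (Vec.there x∈q) = x∈p─q⇒x∉q p q x∈ x∈q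

∣p∪q∣-disjoint : ∀ {n} (p q : Subset n) → (∀ {x} → x ∈ p → x ∉ q) → ∣ p ∪ q ∣ ≡ ∣ p ∣ + ∣ q ∣
∣p∪q∣-disjoint {n} p q disj = begin
  ∣ p ∪ q ∣                ≡⟨ ℕ.+-identityʳ ∣ p ∪ q ∣ ⟨
  ∣ p ∪ q ∣ + 0            ≡⟨ cong (ℕ._+_ (∣ p ∪ q ∣)) (trans (cong ∣_∣ p∩q≡⊥) (∣⊥∣≡0 n)) ⟨
  ∣ p ∪ q ∣ + ∣ p ∩ q ∣    ≡⟨ ∣p∪q∣+∣p∩q∣ p q ⟩
  ∣ p ∣ + ∣ q ∣            ∎
  where
  open ≡-Reasoning
  p∩q≡⊥ : p ∩ q ≡ ⊥
  p∩q≡⊥ = Empty-unique (λ (x , x∈) → disj (proj₁ (x∈p∩q⁻ p q x∈)) (proj₂ (x∈p∩q⁻ p q x∈)))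

∪-⊆ : ∀ {n} {p q r : Subset n} → p ⊆ r → q ⊆ r → p ∪ q ⊆ r
∪-⊆ {p = p} {q} p⊆r q⊆r x∈ with x∈p∪q⁻ p q x∈
... | inj₁ x∈p = p⊆r x∈p
... | inj₂ x∈q = q⊆r x∈q

[p─q]∪q≡p : ∀ {n} {p q : Subset n} → q ⊆ p → (p ─ q) ∪ q ≡ p
[p─q]∪q≡p {p = p} {q} q⊆p = ⊆-antisym (∪-⊆ (p─q⊆p p q) q⊆p) back
  where
  back : p ⊆ (p ─ q) ∪ q
  back {x} x∈p with x ∈? q
  ... | yes x∈q = x∈p∪q⁺ (inj₂ x∈q)
  ... | no  x∉q = x∈p∪q⁺ (inj₁ (x∈p∧x∉q⇒x∈p─q x∈p x∉q))

∣p─q∣+∣q∣ : ∀ {n} {p q : Subset n} → q ⊆ p → ∣ p ─ q ∣ + ∣ q ∣ ≡ ∣ p ∣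
∣p─q∣+∣q∣ {p = p} {q} q⊆p =
  trans (sym (∣p∪q∣-disjoint (p ─ q) q (x∈p─q⇒x∉q p q))) (cong ∣_∣ ([p─q]∪q≡p q⊆p))

∣p∣<∣q∣⇒∃ : ∀ {n} (p q : Subset n) → p ⊆ q → ∣ p ∣ < ∣ q ∣ → ∃ λ x → x ∈ q × x ∉ p
∣p∣<∣q∣⇒∃ {n} p q p⊆q ∣p∣<∣q∣ with nonempty? (q ─ p)
... | yes (x , x∈) = x , p─q⊆p q p x∈ , x∈p─q⇒x∉q q p x∈
... | no empty = contradiction ∣p∣<∣q∣ (ℕ.≤⇒≯ (ℕ.≤-reflexive (trans (sym (∣p─q∣+∣q∣ p⊆q))
    (cong (_+ ∣ p ∣) (trans (cong ∣_∣ (Empty-unique empty)) (∣⊥∣≡0 n))))))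

⊆∧∣≡∣⇒≡ : ∀ {n} {p q : Subset n} → p ⊆ q → ∣ p ∣ ≡ ∣ q ∣ → p ≡ q
⊆∧∣≡∣⇒≡ {p = p} {q} p⊆q eq = ⊆-antisym p⊆q back
  where
  back : q ⊆ p
  back {x} x∈q with x ∈? p
  ... | yes x∈p = x∈p
  ... | no  x∉p = contradiction eq (ℕ.<⇒≢ (p⊂q⇒∣p∣<∣q∣ (p⊆q , x , x∈q , x∉p)))

sum-subsetsOf-card : ∀ {n} (E : Subset n) (ψ : ℕ → ℤ) →
  sumℤ (map (λ A → if A ⊆ᵇ E then ψ (∣ A ∣) else + 0) (allSubsets n)) ≡ binSum (∣ E ∣) ψ
sum-subsetsOf-card [] ψ = cong (ℤ._+ + 0) (sym (ℤ.*-identityˡ (ψ 0)))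
sum-subsetsOf-card {suc n} (y ∷ E) ψ = trans
  (trans (cong sumℤ (List.map-++ g (map (outside ∷_) (allSubsets n)) (map (inside ∷_) (allSubsets n))))
         (sumℤ-++ (map g (map (outside ∷_) (allSubsets n))) (map g (map (inside ∷_) (allSubsets n)))))
  (trans (cong₂ (λ xs ys → sumℤ xs ℤ.+ sumℤ ys) (sym (List.map-∘ (allSubsets n))) (sym (List.map-∘ (allSubsets n))))
  (trans (cong (ℤ._+ sumℤ (map (λ A → g (inside ∷ A)) (allSubsets n))) (sum-subsetsOf-card E ψ)) (last y)))
  where
  g : Subset (suc n) → ℤ
  g A = if A ⊆ᵇ (y ∷ E) then ψ (∣ A ∣) else + 0
  last : ∀ y → binSum (∣ E ∣) ψ ℤ.+ sumℤ (map (λ A → if (inside ∷ A) ⊆ᵇ (y ∷ E) then ψ (∣ inside ∷ A ∣) else + 0) (allSubsets n)) ≡ binSum (∣ y ∷ E ∣) ψ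
  last outside = trans (cong (ℤ._+_ (binSum (∣ E ∣) ψ)) (sumℤ-map-zero (allSubsets n))) (ℤ.+-identityʳ (binSum (∣ E ∣) ψ))
  last inside  = trans (cong (ℤ._+_ (binSum (∣ E ∣) ψ)) (sum-subsetsOf-card E (λ i → ψ (suc i)))) (sym (binSum-suc (∣ E ∣) ψ))

sum-subsetsOf : ∀ {n} (E : Subset n) (φ : Subset n → ℤ) (ψ : ℕ → ℤ) → (∀ A → A ⊆ E → φ A ≡ ψ (∣ A ∣)) →
  sumℤ (map φ (subsetsOf E)) ≡ binSum (∣ E ∣) ψ
sum-subsetsOf {n} E φ ψ φ≡ψ = trans (sumℤ-filterᵇ (_⊆ᵇ E) φ (allSubsets n))
  (trans (sumℤ-map-cong pointwise (allSubsets n)) (sum-subsetsOf-card E ψ))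
  where
  pointwise : ∀ A → (if A ⊆ᵇ E then φ A else + 0) ≡ (if A ⊆ᵇ E then ψ (∣ A ∣) else + 0)
  pointwise A with A ⊆ᵇ E | ⊆ᵇ⇒⊆ A E
  ... | true  | A⊆E = φ≡ψ A (A⊆E _)
  ... | false | _   = refl

-- Restricted to subsets of `E` because a contraction lives on the same `Fin n`, and `contrRank r F`
-- need not be uniform on sets that meet `F`.
IsUniform : ∀ {n} → Subset n → (Subset n → ℕ) → ℕ → Set
IsUniform E r d = ∀ A → A ⊆ E → r A ≡ ∣ A ∣ ⊓ d

-- Concavity of x ↦ x ⊓ d: the pair u, i has the same sum as a, b and is spread further apart.
⊓-submodular : ∀ d u i a b → u + i ≡ a + b → i ≤ a → i ≤ b → u ⊓ d + i ⊓ d ≤ a ⊓ d + b ⊓ d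
⊓-submodular d u i a b u+i≡a+b i≤a i≤b with ℕ.≤-total a d | ℕ.≤-total b d
... | inj₁ a≤d | inj₁ b≤d = begin
  u ⊓ d + i ⊓ d   ≤⟨ ℕ.+-mono-≤ (ℕ.m⊓n≤m u d) (ℕ.m⊓n≤m i d) ⟩
  u + i           ≡⟨ u+i≡a+b ⟩
  a + b           ≡⟨ cong₂ _+_ (ℕ.m≤n⇒m⊓n≡m a≤d) (ℕ.m≤n⇒m⊓n≡m b≤d) ⟨
  a ⊓ d + b ⊓ d   ∎
  where open ℕ.≤-Reasoning
... | inj₂ d≤a | _ = begin
  u ⊓ d + i ⊓ d   ≤⟨ ℕ.+-mono-≤ (ℕ.m⊓n≤n u d) (ℕ.⊓-monoˡ-≤ d i≤b) ⟩
  d + b ⊓ d       ≡⟨ cong (_+ b ⊓ d) (ℕ.m≥n⇒m⊓n≡n d≤a) ⟨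
  a ⊓ d + b ⊓ d   ∎
  where open ℕ.≤-Reasoning
... | inj₁ _ | inj₂ d≤b = begin
  u ⊓ d + i ⊓ d   ≤⟨ ℕ.+-mono-≤ (ℕ.m⊓n≤n u d) (ℕ.⊓-monoˡ-≤ d i≤a) ⟩
  d + a ⊓ d       ≡⟨ ℕ.+-comm d (a ⊓ d) ⟩
  a ⊓ d + d       ≡⟨ cong (ℕ._+_ (a ⊓ d)) (ℕ.m≥n⇒m⊓n≡n d≤b) ⟨
  a ⊓ d + b ⊓ d   ∎
  where open ℕ.≤-Reasoning

-- Positivity of `d` is asked only in the presence of an element, so that the empty matroid of rank
-- 0 left by contracting the whole ground set is covered.
uniform-loopless : ∀ {n} {E : Subset n} {r d} → IsUniform E r d → (∀ e → e ∈ E → 1 ≤ d) → IsLooplessMatroid n E r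
uniform-loopless {E = E} {r} {d} unif pos = record
  { rank-≤-card = λ A A⊆E → ℕ.≤-trans (ℕ.≤-reflexive (unif A A⊆E)) (ℕ.m⊓n≤m ∣ A ∣ d)
  ; rank-mono   = λ A B A⊆B B⊆E → begin
      r A          ≡⟨ unif A (λ x∈A → B⊆E (A⊆B x∈A)) ⟩
      ∣ A ∣ ⊓ d    ≤⟨ ℕ.⊓-monoˡ-≤ d (p⊆q⇒∣p∣≤∣q∣ A⊆B) ⟩
      ∣ B ∣ ⊓ d    ≡⟨ unif B B⊆E ⟨
      r B          ∎
  ; rank-submod = λ A B A⊆E B⊆E → begin
      r (A ∪ B) + r (A ∩ B)            ≡⟨ cong₂ _+_ (unif (A ∪ B) (∪-⊆ A⊆E B⊆E)) (unif (A ∩ B) (λ x∈ → A⊆E (p∩q⊆p A B x∈))) ⟩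
      ∣ A ∪ B ∣ ⊓ d + ∣ A ∩ B ∣ ⊓ d    ≤⟨ ⊓-submodular d (∣ A ∪ B ∣) (∣ A ∩ B ∣) (∣ A ∣) (∣ B ∣) (∣p∪q∣+∣p∩q∣ A B) (∣p∩q∣≤∣p∣ A B) (∣p∩q∣≤∣q∣ A B) ⟩
      ∣ A ∣ ⊓ d + ∣ B ∣ ⊓ d            ≡⟨ cong₂ _+_ (unif A A⊆E) (unif B B⊆E) ⟨
      r A + r B                        ∎
  ; loopless    = λ e e∈E → trans (unif ⁅ e ⁆ (λ {x} x∈ → subst (_∈ E) (sym (x∈⁅y⁆⇒x≡y e x∈)) e∈E))
                                  (trans (cong (_⊓ d) (∣⁅x⁆∣≡1 e)) (ℕ.m≤n⇒m⊓n≡m (pos e e∈E)))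
  }
  where open ℕ.≤-Reasoning

contraction-rank : ∀ a f d → (a + f) ⊓ d ∸ f ⊓ d ≡ a ⊓ (d ∸ f)
contraction-rank a f d with ℕ.≤-total f d
... | inj₁ f≤d = begin
  (a + f) ⊓ d ∸ f ⊓ d            ≡⟨ cong (λ z → (a + f) ⊓ d ∸ z) (ℕ.m≤n⇒m⊓n≡m f≤d) ⟩
  (a + f) ⊓ d ∸ f                ≡⟨ ℕ.∸-distribʳ-⊓ f (a + f) d ⟩
  (a + f ∸ f) ⊓ (d ∸ f)          ≡⟨ cong (_⊓ (d ∸ f)) (ℕ.m+n∸n≡m a f) ⟩
  a ⊓ (d ∸ f)                    ∎
  where open ≡-Reasoning
... | inj₂ d≤f = begin
  (a + f) ⊓ d ∸ f ⊓ d            ≡⟨ cong₂ _∸_ (ℕ.m≥n⇒m⊓n≡n (ℕ.≤-trans d≤f (ℕ.m≤n+m f a))) (ℕ.m≥n⇒m⊓n≡n d≤f) ⟩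
  d ∸ d                          ≡⟨ ℕ.n∸n≡0 d ⟩
  0                              ≡⟨ ℕ.⊓-zeroʳ a ⟨
  a ⊓ 0                          ≡⟨ cong (a ⊓_) (ℕ.m≤n⇒m∸n≡0 d≤f) ⟨
  a ⊓ (d ∸ f)                    ∎
  where open ≡-Reasoning

uniform-contraction : ∀ {n} {E F : Subset n} {r d} → IsUniform E r d → F ⊆ E → IsUniform (E ─ F) (contrRank r F) (d ∸ ∣ F ∣)
uniform-contraction {E = E} {F} {r} {d} unif F⊆E A A⊆E─F = begin
  r (A ∪ F) ∸ r F                        ≡⟨ cong₂ _∸_ (unif (A ∪ F) (∪-⊆ (λ x∈ → p─q⊆p E F (A⊆E─F x∈)) F⊆E)) (unif F F⊆E) ⟩
  ∣ A ∪ F ∣ ⊓ d ∸ ∣ F ∣ ⊓ d              ≡⟨ cong (λ z → z ⊓ d ∸ ∣ F ∣ ⊓ d) (∣p∪q∣-disjoint A F (λ x∈ → x∈p─q⇒x∉q E F (A⊆E─F x∈))) ⟩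
  (∣ A ∣ + ∣ F ∣) ⊓ d ∸ ∣ F ∣ ⊓ d        ≡⟨ contraction-rank (∣ A ∣) (∣ F ∣) d ⟩
  ∣ A ∣ ⊓ (d ∸ ∣ F ∣)                    ∎
  where open ≡-Reasoning

-- The exponent keeps its minima so that one formula serves both kinds of flats: for |F| < d it
-- becomes |F| - a, the Boolean case, and for the ground set it is d - a ⊓ d.
charPoly-*P : ∀ {n} {E F : Subset n} {r d} → IsUniform E r d → F ⊆ E → ∀ q D →
  (charPoly F r *P q) D ≡ binSum (∣ F ∣) (λ a → sgn a ℤ.* revP D q (∣ F ∣ ⊓ d ∸ a ⊓ d))
charPoly-*P {F = F} {r} {d} unif F⊆E q D = begin
  (charPoly F r *P q) D
    ≡⟨ sumℤ-upTo (suc D) (λ j → charPoly F r j ℤ.* q (D ∸ j)) ⟩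
  ∑ (suc D) (λ j → charPoly F r j ℤ.* q (D ∸ j))
    ≡⟨ ∑-cong (suc D) (λ j _ → trans
         (cong (ℤ._* q (D ∸ j)) (sum-subsetsOf F (λ A → if (r F ∸ r A) ≡ᵇ j then sgn (∣ A ∣) else + 0) (λ a → indicator a j) (λ A A⊆F →
           cong₂ (λ x y → if (x ∸ y) ≡ᵇ j then sgn (∣ A ∣) else + 0) (unif F F⊆E) (unif A (λ x∈ → F⊆E (A⊆F x∈))))))
         (ℤ.*-comm (binSum (∣ F ∣) (λ a → indicator a j)) (q (D ∸ j)))) ⟩
  ∑ (suc D) (λ j → q (D ∸ j) ℤ.* binSum (∣ F ∣) (λ a → indicator a j))
    ≡⟨ ∑-*-∑ (suc (∣ F ∣)) (suc D) (bin (∣ F ∣)) (λ j → q (D ∸ j)) indicator ⟩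
  binSum (∣ F ∣) (λ a → ∑ (suc D) (λ j → q (D ∸ j) ℤ.* indicator a j))
    ≡⟨ ∑-cong (suc (∣ F ∣)) (λ a _ → cong (bin (∣ F ∣) a ℤ.*_) (trans
         (∑-cong (suc D) (λ j _ → ℤ.*-comm (q (D ∸ j)) (indicator a j)))
         (∑-delta D (∣ F ∣ ⊓ d ∸ a ⊓ d) (sgn a) q))) ⟩
  binSum (∣ F ∣) (λ a → sgn a ℤ.* revP D q (∣ F ∣ ⊓ d ∸ a ⊓ d)) ∎
  where
  open ≡-Reasoning
  indicator : ℕ → ℕ → ℤ
  indicator a j = if (∣ F ∣ ⊓ d ∸ a ⊓ d) ≡ᵇ j then sgn a else + 0

-- Flats of a uniform matroid

allᵇ-true : ∀ {A : Set} {p : A → Bool} → (∀ x → p x ≡ true) → ∀ xs → allᵇ p xs ≡ true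
allᵇ-true px []       = refl
allᵇ-true px (x ∷ xs) = cong₂ _∧_ (px x) (allᵇ-true px xs)

allᵇ-false : ∀ {A : Set} {p : A → Bool} {x xs} → x ∈ˡ xs → p x ≡ false → allᵇ p xs ≡ false
allᵇ-false {p = p} {xs = y ∷ xs} (here refl) px = cong (_∧ allᵇ p xs) px
allᵇ-false {p = p} {xs = y ∷ xs} (there x∈)  px = trans (cong (p y ∧_) (allᵇ-false x∈ px)) (∧-zeroʳ (p y))

∪⁅⁆-⊆ : ∀ {n} {E F : Subset n} {e} → F ⊆ E → e ∈ E → F ∪ ⁅ e ⁆ ⊆ E
∪⁅⁆-⊆ {E = E} {e = e} F⊆E e∈E = ∪-⊆ F⊆E (λ x∈ → subst (_∈ E) (sym (x∈⁅y⁆⇒x≡y e x∈)) e∈E)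

∣F∪⁅e⁆∣ : ∀ {n} (F : Subset n) {e} → e ∉ F → ∣ F ∪ ⁅ e ⁆ ∣ ≡ suc (∣ F ∣)
∣F∪⁅e⁆∣ F {e} e∉F = trans (∣p∪q∣-disjoint F ⁅ e ⁆ (λ x∈F x∈e → e∉F (subst (_∈ F) (x∈⁅y⁆⇒x≡y e x∈e) x∈F)))
  (trans (cong (ℕ._+_ (∣ F ∣)) (∣⁅x⁆∣≡1 e)) (ℕ.+-comm ∣ F ∣ 1))

isFlat-true : ∀ {n} {E F : Subset n} {r} → F ⊆ E → (∀ e → e ∈ E → e ∉ F → r F < r (F ∪ ⁅ e ⁆)) → isFlat E r F ≡ true
isFlat-true {n} {E} {F} {r} F⊆E increases = cong₂ _∧_ (⊆⇒⊆ᵇ F E F⊆E) (allᵇ-true each (allFin n))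
  where
  each : ∀ e → (not ((e ∈ᵇ E) ∧ not (e ∈ᵇ F)) ∨ (r F <ᵇ r (F ∪ ⁅ e ⁆))) ≡ true
  each e with e ∈? E | e ∈? F
  ... | no e∉E  | _       = cong (λ b → not (b ∧ not (e ∈ᵇ F)) ∨ (r F <ᵇ r (F ∪ ⁅ e ⁆))) (∈ᵇ-false e∉E)
  ... | yes e∈E | yes e∈F = cong₂ (λ b c → not (b ∧ not c) ∨ (r F <ᵇ r (F ∪ ⁅ e ⁆))) (∈ᵇ-true e∈E) (∈ᵇ-true e∈F)
  ... | yes e∈E | no e∉F  = trans (cong₂ (λ b c → not (b ∧ not c) ∨ (r F <ᵇ r (F ∪ ⁅ e ⁆))) (∈ᵇ-true e∈E) (∈ᵇ-false e∉F))
    (T⇒≡true (ℕ.<⇒<ᵇ (increases e e∈E e∉F)))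

isFlat-false : ∀ {n} {E F : Subset n} {r} e → e ∈ E → e ∉ F → r F ≡ r (F ∪ ⁅ e ⁆) → isFlat E r F ≡ false
isFlat-false {n} {E} {F} {r} e e∈E e∉F eq = trans (cong ((F ⊆ᵇ E) ∧_) (allᵇ-false (∈-allFin e)
  (trans (cong₂ (λ b c → not (b ∧ not c) ∨ (r F <ᵇ r (F ∪ ⁅ e ⁆))) (∈ᵇ-true e∈E) (∈ᵇ-false e∉F))
         (¬T⇒≡false (λ t → ℕ.<⇒≢ (ℕ.<ᵇ⇒< (r F) (r (F ∪ ⁅ e ⁆)) t) eq)))))
  (∧-zeroʳ (F ⊆ᵇ E))

-- Being a flat depends on the size alone: below d every new element raises the rank, and from d up
-- to |E| - 1 none does. The sum thus runs over all subsets with a weight `ψ` of the size that is 0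
-- in the gap; 1 ≤ m keeps |E| apart from the sizes below d and from d itself.
sum-flats : ∀ {n} {E : Subset n} {r d} m → IsUniform E r d → ∣ E ∣ ≡ m + d → 1 ≤ m →
  (g : Subset n → ℤ) (τ : ℕ → ℤ) → (∀ F → F ⊆ E → ∣ F ∣ < d → g F ≡ τ (∣ F ∣)) →
  sumℤ (map g (flats E r)) ≡ ∑ d (λ j → bin (m + d) j ℤ.* τ j) ℤ.+ g E
sum-flats {n} {E} {r} {d} m unif ∣E∣≡ 1≤m g τ g≡τ = begin
  sumℤ (map g (flats E r))
    ≡⟨ sumℤ-filterᵇ (isFlat E r) g (subsetsOf E) ⟩
  sumℤ (map (λ F → if isFlat E r F then g F else + 0) (subsetsOf E))
    ≡⟨ sum-subsetsOf E (λ F → if isFlat E r F then g F else + 0) ψ value ⟩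
  binSum (∣ E ∣) ψ
    ≡⟨ cong (λ z → binSum z ψ) ∣E∣≡ ⟩
  ∑ (suc (m + d)) (λ j → bin (m + d) j ℤ.* ψ j)
    ≡⟨ ∑-last (m + d) (λ j → bin (m + d) j ℤ.* ψ j) ⟩
  ∑ (m + d) (λ j → bin (m + d) j ℤ.* ψ j) ℤ.+ bin (m + d) (m + d) ℤ.* ψ (m + d)
    ≡⟨ cong₂ ℤ._+_
         (trans (∑-extend (ℕ.m≤n+m d m) (λ j → bin (m + d) j ℤ.* ψ j)
                  (λ j d≤j j<n → trans (cong (bin (m + d) j ℤ.*_) (ψ-mid j d≤j (subst (j <_) (sym ∣E∣≡) j<n))) (ℤ.*-zeroʳ (bin (m + d) j))))
                (∑-cong d (λ j j<d → cong (bin (m + d) j ℤ.*_) (ψ-low j j<d))))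
         (trans (cong₂ ℤ._*_ (bin-nn (m + d)) (trans (cong ψ (sym ∣E∣≡)) ψ-top)) (ℤ.*-identityˡ (g E))) ⟩
  ∑ d (λ j → bin (m + d) j ℤ.* τ j) ℤ.+ g E ∎
  where
  open ≡-Reasoning
  ψ : ℕ → ℤ
  ψ j = if j <ᵇ d then τ j else (if j ≡ᵇ ∣ E ∣ then g E else + 0)

  d<∣E∣ : d < ∣ E ∣
  d<∣E∣ = subst (d <_) (sym ∣E∣≡) (ℕ.+-monoˡ-≤ d 1≤m)

  ψ-low : ∀ j → j < d → ψ j ≡ τ j
  ψ-low j j<d = cong (λ b → if b then τ j else (if j ≡ᵇ ∣ E ∣ then g E else + 0)) (T⇒≡true (ℕ.<⇒<ᵇ j<d))

  ψ-high : ∀ j → d ≤ j → ψ j ≡ (if j ≡ᵇ ∣ E ∣ then g E else + 0)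
  ψ-high j d≤j = cong (λ b → if b then τ j else (if j ≡ᵇ ∣ E ∣ then g E else + 0)) (¬T⇒≡false (λ t → ℕ.≤⇒≯ d≤j (ℕ.<ᵇ⇒< j d t)))

  ψ-mid : ∀ j → d ≤ j → j < ∣ E ∣ → ψ j ≡ + 0
  ψ-mid j d≤j j<∣E∣ = trans (ψ-high j d≤j) (cong (λ b → if b then g E else + 0) (≢⇒≡ᵇ≡false (ℕ.<⇒≢ j<∣E∣)))

  ψ-top : ψ (∣ E ∣) ≡ g E
  ψ-top = trans (ψ-high (∣ E ∣) (ℕ.<⇒≤ d<∣E∣)) (cong (λ b → if b then g E else + 0) (n≡ᵇn (∣ E ∣)))

  value : ∀ F → F ⊆ E → (if isFlat E r F then g F else + 0) ≡ ψ (∣ F ∣)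
  value F F⊆E with ∣ F ∣ ℕ.<? d
  ... | yes ∣F∣<d = trans (cong (λ b → if b then g F else + 0) (isFlat-true {r = r} F⊆E increases)) (trans (g≡τ F F⊆E ∣F∣<d) (sym (ψ-low (∣ F ∣) ∣F∣<d)))
    where
    increases : ∀ e → e ∈ E → e ∉ F → r F < r (F ∪ ⁅ e ⁆)
    increases e e∈E e∉F = ℕ.≤-reflexive (begin
      suc (r F)                  ≡⟨ cong suc (trans (unif F F⊆E) (ℕ.m≤n⇒m⊓n≡m (ℕ.<⇒≤ ∣F∣<d))) ⟩
      suc (∣ F ∣)                  ≡⟨ ℕ.m≤n⇒m⊓n≡m ∣F∣<d ⟨
      suc (∣ F ∣) ⊓ d              ≡⟨ cong (_⊓ d) (∣F∪⁅e⁆∣ F e∉F) ⟨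
      ∣ F ∪ ⁅ e ⁆ ∣ ⊓ d          ≡⟨ unif (F ∪ ⁅ e ⁆) (∪⁅⁆-⊆ F⊆E e∈E) ⟨
      r (F ∪ ⁅ e ⁆)              ∎)
  ... | no ∣F∣≮d with ∣ F ∣ ℕ.≟ ∣ E ∣
  ...   | yes ∣F∣≡∣E∣ rewrite ⊆∧∣≡∣⇒≡ F⊆E ∣F∣≡∣E∣ =
    trans (cong (λ b → if b then g E else + 0) (isFlat-true {E = E} {E} {r} (λ x∈ → x∈) (λ e e∈E e∉E → contradiction e∈E e∉E))) (sym ψ-top)
  ...   | no ∣F∣≢∣E∣ = trans (cong (λ b → if b then g F else + 0) notFlat) (sym (ψ-mid (∣ F ∣) (ℕ.≮⇒≥ ∣F∣≮d) ∣F∣<∣E∣))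
    where
    ∣F∣<∣E∣ : ∣ F ∣ < ∣ E ∣
    ∣F∣<∣E∣ = ℕ.≤∧≢⇒< (p⊆q⇒∣p∣≤∣q∣ F⊆E) ∣F∣≢∣E∣
    notFlat : isFlat E r F ≡ false
    notFlat with ∣p∣<∣q∣⇒∃ F E F⊆E ∣F∣<∣E∣
    ... | e , e∈E , e∉F = isFlat-false {r = r} e e∈E e∉F (begin
      r F                        ≡⟨ trans (unif F F⊆E) (ℕ.m≥n⇒m⊓n≡n (ℕ.≮⇒≥ ∣F∣≮d)) ⟩
      d                          ≡⟨ ℕ.m≥n⇒m⊓n≡n (ℕ.≤-trans (ℕ.≮⇒≥ ∣F∣≮d) (∣p∣≤∣p∪q∣ F ⁅ e ⁆)) ⟨
      ∣ F ∪ ⁅ e ⁆ ∣ ⊓ d          ≡⟨ unif (F ∪ ⁅ e ⁆) (∪⁅⁆-⊆ F⊆E e∈E) ⟨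
      r (F ∪ ⁅ e ⁆)              ∎)

-- Kazhdan–Lusztig coefficients of uniform matroids

-- With d = β + 1 + i the hypothesis says d ≤ 2i: the formula respects the degree bound by itself.
U-vanish : ∀ μ β i → suc β ≤ i → U μ β i ≡ + 0
U-vanish μ β i β<i = ∑-zero (suc μ) (λ h _ → trans
  (cong (coeff μ β h ℤ.*_) (n<k⇒bin≡0 (ℕ.≤-<-trans β<i (ℕ.m<m+n i {suc h} (s≤s z≤n)))))
  (ℤ.*-zeroʳ (coeff μ β h)))

revP-cong : ∀ D {p q : Poly} → (∀ y → p y ≡ q y) → ∀ x → revP D p x ≡ revP D q x
revP-cong D p≡q x = cong (λ z → if x ≤ᵇ D then z else + 0) (p≡q (D ∸ x))

revP-1P : ∀ D x → x ≢ D → revP D 1P x ≡ + 0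
revP-1P D x x≢D with x ℕ.≤? D
... | no x≰D = revP-> D 1P (ℕ.≰⇒> x≰D)
... | yes x≤D = trans (revP-≤ D 1P x≤D)
  (cong (λ b → if b then + 1 else + 0) (≢⇒≡ᵇ≡false (λ D∸x≡0 → x≢D (ℕ.≤-antisym x≤D (ℕ.m∸n≡0⇒m≤n D∸x≡0)))))

KL : Set
KL = (n : ℕ) → Subset n → (Subset n → ℕ) → Poly

uniform-rank : ∀ {n} {E : Subset n} {r d} → IsUniform E r d → d ≤ ∣ E ∣ → r E ≡ d
uniform-rank {E = E} unif d≤∣E∣ = trans (unif E (λ x∈ → x∈)) (ℕ.m≥n⇒m⊓n≡n d≤∣E∣)

kl-vanish : ∀ {P} → IsKLAssignment P → ∀ {n} {E : Subset n} {r d} → IsUniform E r d → d ≤ ∣ E ∣ → 0 < d →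
  ∀ i → d ≤ 2 ℕ.* i → P n E r i ≡ + 0
kl-vanish kl {n} {E} {r} unif d≤∣E∣ 0<d i d≤2i =
  proj₁ (proj₂ (kl n E r (uniform-loopless unif (λ _ _ → 0<d))))
    (subst (0 <_) (sym rank) 0<d) i (subst (_≤ 2 ℕ.* i) (sym rank) d≤2i)
  where
  rank : r E ≡ _
  rank = uniform-rank unif d≤∣E∣

kl-empty-contraction : ∀ {P} → IsKLAssignment P → ∀ {n} {E : Subset n} {r d} → IsUniform E r d → d ≤ ∣ E ∣ →
  ∀ k → P n (E ─ E) (contrRank r E) k ≡ 1P k
kl-empty-contraction kl {n} {E} {r} {d} unif d≤∣E∣ =
  proj₁ (kl n (E ─ E) (contrRank r E)
    (uniform-loopless unif′ (λ e e∈ → contradiction (p─q⊆p E E e∈) (x∈p─q⇒x∉q E E e∈))))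
    (trans (unif′ (E ─ E) (λ x∈ → x∈)) (trans (cong (∣ E ─ E ∣ ⊓_) (ℕ.m≤n⇒m∸n≡0 d≤∣E∣)) (ℕ.⊓-zeroʳ (∣ E ─ E ∣))))
  where
  unif′ : IsUniform (E ─ E) (contrRank r E) (d ∸ ∣ E ∣)
  unif′ = uniform-contraction unif (λ x∈ → x∈)

-- Ranges over all presentations of U_{m,d} on subsets of any `Fin n`, since `IsKLAssignment` treats
-- each presentation separately and contractions do not return to the standard one. Here β is d - 1
-- - i, and every i < d is included.
KLValue : KL → ℕ → ℕ → Set
KLValue P μ d = ∀ {n} (E : Subset n) r → IsUniform E r d → ∣ E ∣ ≡ suc μ + d →
  ∀ β i → suc β + i ≡ d → + suc β ℤ.* P n E r i ≡ bin (suc μ + d) i ℤ.* U μ β i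

m+n≤2*n : ∀ {m n} → m ≤ n → m + n ≤ 2 ℕ.* n
m+n≤2*n {m} {n} m≤n = ℕ.≤-trans (ℕ.+-monoˡ-≤ n m≤n) (ℕ.≤-reflexive (cong (ℕ._+_ n) (sym (ℕ.+-identityʳ n))))

module _ {P : KL} (kl : IsKLAssignment P) (μ : ℕ) where

  private
    uniformValue : ℕ → ℕ → ℤ
    uniformValue e i = P (suc μ + e) ⊤ (uniformRank e) i

    rank≤card : ∀ {n} (E : Subset n) {e} → ∣ E ∣ ≡ suc μ + e → e ≤ ∣ E ∣
    rank≤card E {e} ∣E∣≡ = subst (e ≤_) (sym ∣E∣≡) (ℕ.m≤n+m e (suc μ))

    uniformValue-vanish : ∀ e i → 0 < e → e ≤ 2 ℕ.* i → uniformValue e i ≡ + 0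
    uniformValue-vanish e = λ i 0<e → kl-vanish kl (λ _ _ → refl) (rank≤card (⊤ {suc μ + e}) (∣⊤∣≡n (suc μ + e))) 0<e i

    -- Independence of the presentation: up to the degree bound both values satisfy the same
    -- equation, whose factor β + 1 cancels; above the bound both are 0.
    value-agree : ∀ {e} → KLValue P μ e → 0 < e → ∀ {n} (E : Subset n) r → IsUniform E r e → ∣ E ∣ ≡ suc μ + e →
      ∀ y → P n E r y ≡ uniformValue e y
    value-agree {e} value 0<e {n} E r unif ∣E∣≡ y with e ℕ.≤? 2 ℕ.* y
    ... | yes e≤2y = trans (kl-vanish kl unif (rank≤card E ∣E∣≡) 0<e y e≤2y) (sym (uniformValue-vanish e y 0<e e≤2y))
    ... | no e≰2y with ℕ.m≤n⇒∃[o]m+o≡n (ℕ.≤-<-trans (ℕ.m≤m+n y (y + 0)) (ℕ.≰⇒> e≰2y))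
    ... | β , 1+y+β≡e = ℤ.*-cancelˡ-≡ (+ suc β) (P n E r y) (uniformValue e y)
      (trans (value E r unif ∣E∣≡ β y eq) (sym (value ⊤ (uniformRank e) (λ _ _ → refl) (∣⊤∣≡n (suc μ + e)) β y eq)))
      where
      eq : suc β + y ≡ e
      eq = trans (cong suc (ℕ.+-comm β y)) 1+y+β≡e

    value-high : ∀ {d n} (E : Subset n) r → IsUniform E r d → ∣ E ∣ ≡ suc μ + d →
      ∀ β i → suc β + i ≡ d → suc β ≤ i → + suc β ℤ.* P n E r i ≡ bin (suc μ + d) i ℤ.* U μ β i
    value-high {d} {n} E r unif ∣E∣≡ β i refl β<i = begin
      + suc β ℤ.* P n E r i              ≡⟨ cong (+ suc β ℤ.*_) (kl-vanish kl unif (rank≤card E ∣E∣≡) (s≤s z≤n) i (m+n≤2*n β<i)) ⟩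
      + suc β ℤ.* + 0                    ≡⟨ ℤ.*-zeroʳ (+ suc β) ⟩
      + 0                                ≡⟨ ℤ.*-zeroʳ (bin (suc μ + d) i) ⟨
      bin (suc μ + d) i ℤ.* + 0          ≡⟨ cong (bin (suc μ + d) i ℤ.*_) (U-vanish μ β i β<i) ⟨
      bin (suc μ + d) i ℤ.* U μ β i      ∎
      where open ≡-Reasoning

    kl-recurrence : ∀ {n} (E : Subset n) r β k → let D = suc β; d = D + k in k ≤ β →
      (∀ {e} → e < d → KLValue P μ e) → IsUniform E r d → ∣ E ∣ ≡ suc μ + d →
      P n E r k ≡ ∑ d (klTerm uniformValue (suc μ + d) d D) ℤ.+ sgn k ℤ.* bin (suc μ + d) k
    kl-recurrence {n} E r β k k≤β ih unif ∣E∣≡ = begin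
      P n E r k
        ≡⟨ cong (P n E r) (ℕ.m+n∸m≡n D k) ⟨
      P n E r (d ∸ D)
        ≡⟨ revP-≤ d (P n E r) (ℕ.m≤m+n D k) ⟨
      revP d (P n E r) D
        ≡⟨ cong (λ z → revP z (P n E r) D) (uniform-rank unif d≤∣E∣) ⟨
      revP (r E) (P n E r) D
        ≡⟨ proj₂ (proj₂ (kl n E r (uniform-loopless unif (λ _ _ → s≤s z≤n)))) D ⟩
      sumP (map (λ F → charPoly F r *P P n (E ─ F) (contrRank r F)) (flats E r)) D
        ≡⟨ sumP-map (λ F → charPoly F r *P P n (E ─ F) (contrRank r F)) (flats E r) D ⟩
      sumℤ (map g (flats E r))
        ≡⟨ sum-flats (suc μ) unif ∣E∣≡ (s≤s z≤n) g τ proper ⟩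
      ∑ d (klTerm uniformValue (suc μ + d) d D) ℤ.+ g E
        ≡⟨ cong (ℤ._+_ (∑ d (klTerm uniformValue (suc μ + d) d D))) whole ⟩
      ∑ d (klTerm uniformValue (suc μ + d) d D) ℤ.+ sgn k ℤ.* bin (suc μ + d) k ∎
      where
      open ≡-Reasoning
      D d : ℕ
      D = suc β
      d = D + k
      g : Subset n → ℤ
      g F = (charPoly F r *P P n (E ─ F) (contrRank r F)) D
      τ : ℕ → ℤ
      τ j = binSum j (λ s → sgn s ℤ.* revP D (uniformValue (d ∸ j)) (j ∸ s))
      d≤∣E∣ : d ≤ ∣ E ∣
      d≤∣E∣ = rank≤card E ∣E∣≡
      d≤2D : d ≤ 2 ℕ.* D
      d≤2D = subst (_≤ 2 ℕ.* D) (ℕ.+-comm k D) (m+n≤2*n (ℕ.m≤n⇒m≤1+n k≤β))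

      proper : ∀ F → F ⊆ E → ∣ F ∣ < d → g F ≡ τ (∣ F ∣)
      proper F F⊆E ∣F∣<d = trans (charPoly-*P unif F⊆E q D) (∑-cong (suc (∣ F ∣)) (λ a a≤∣F∣ →
        cong (λ z → bin (∣ F ∣) a ℤ.* (sgn a ℤ.* z)) (trans
          (cong₂ (λ x y → revP D q (x ∸ y)) (ℕ.m≤n⇒m⊓n≡m (ℕ.<⇒≤ ∣F∣<d)) (ℕ.m≤n⇒m⊓n≡m (ℕ.≤-trans (ℕ.≤-pred a≤∣F∣) (ℕ.<⇒≤ ∣F∣<d))))
          (agree a))))
        where
        e : ℕ
        e = d ∸ ∣ F ∣
        q : Poly
        q = P n (E ─ F) (contrRank r F)
        0<e : 0 < e
        0<e = ℕ.m<n⇒0<n∸m ∣F∣<d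
        unif′ : IsUniform (E ─ F) (contrRank r F) e
        unif′ = uniform-contraction unif F⊆E
        size : ∣ E ─ F ∣ ≡ suc μ + e
        size = ℕ.+-cancelʳ-≡ (∣ F ∣) (∣ E ─ F ∣) (suc μ + e) (trans (∣p─q∣+∣q∣ F⊆E) (trans ∣E∣≡
          (trans (cong (ℕ._+_ (suc μ)) (sym (ℕ.m∸n+n≡m (ℕ.<⇒≤ ∣F∣<d)))) (sym (ℕ.+-assoc (suc μ) e (∣ F ∣))))))
        -- For F = ∅ the induction hypothesis is not available, but then only the coefficient of t^D matters,
        -- which vanishes for degree reasons.
        agree : ∀ a → revP D q (∣ F ∣ ∸ a) ≡ revP D (uniformValue e) (∣ F ∣ ∸ a)
        agree a with 0 ℕ.<? ∣ F ∣
        ... | yes 0<∣F∣ = revP-cong D (value-agree (ih (ℕ.∸-monoʳ-< 0<∣F∣ (ℕ.<⇒≤ ∣F∣<d))) 0<e (E ─ F) (contrRank r F) unif′ size) (∣ F ∣ ∸ a)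
        ... | no  0≮∣F∣ = subst (λ z → revP D q z ≡ revP D (uniformValue e) z)
          (sym (ℕ.m≤n⇒m∸n≡0 {∣ F ∣} {a} (ℕ.≤-trans (ℕ.≮⇒≥ 0≮∣F∣) z≤n)))
          (trans (kl-vanish kl unif′ (rank≤card (E ─ F) size) 0<e D e≤2D) (sym (uniformValue-vanish e D 0<e e≤2D)))
          where
          e≤2D : e ≤ 2 ℕ.* D
          e≤2D = ℕ.≤-trans (ℕ.m∸n≤m d (∣ F ∣)) d≤2D

      whole : g E ≡ sgn k ℤ.* bin (suc μ + d) k
      whole = begin
        g E
          ≡⟨ charPoly-*P unif (λ x∈ → x∈) (P n (E ─ E) (contrRank r E)) D ⟩
        binSum (∣ E ∣) (λ a → sgn a ℤ.* revP D (P n (E ─ E) (contrRank r E)) (∣ E ∣ ⊓ d ∸ a ⊓ d))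
          ≡⟨ cong₂ (λ N x → ∑ (suc N) (λ a → bin N a ℤ.* (sgn a ℤ.* revP D (P n (E ─ E) (contrRank r E)) (x ∸ a ⊓ d)))) ∣E∣≡ (ℕ.m≥n⇒m⊓n≡n d≤∣E∣) ⟩
        binSum (suc μ + d) (λ a → sgn a ℤ.* revP D (P n (E ─ E) (contrRank r E)) (d ∸ a ⊓ d))
          ≡⟨ ∑-cong (suc (suc μ + d)) (λ a _ → cong (λ z → bin (suc μ + d) a ℤ.* (sgn a ℤ.* z)) (revP-cong D (kl-empty-contraction kl unif d≤∣E∣) (d ∸ a ⊓ d))) ⟩
        ∑ (suc (suc μ + d)) f
          -- This is the coefficient of t^D in the characteristic polynomial of the whole matroid.
          -- Subsets of size at least d feed only t^0, and D > 0, so only size k = d - D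
          -- contributes.
          ≡⟨ ∑-single f (s≤s (ℕ.≤-trans (ℕ.m≤n+m k D) (ℕ.m≤n+m d (suc μ)))) off ⟩
        f k
          ≡⟨ cong (λ x → bin (suc μ + d) k ℤ.* (sgn k ℤ.* revP D 1P x)) (trans (cong (d ∸_) (ℕ.m≤n⇒m⊓n≡m (ℕ.m≤n+m k D))) (ℕ.m+n∸n≡m D k)) ⟩
        bin (suc μ + d) k ℤ.* (sgn k ℤ.* revP D 1P D)
          ≡⟨ cong (λ z → bin (suc μ + d) k ℤ.* (sgn k ℤ.* z)) (trans (revP-≤ D 1P ℕ.≤-refl) (cong 1P (ℕ.n∸n≡0 D))) ⟩
        bin (suc μ + d) k ℤ.* (sgn k ℤ.* + 1)
          ≡⟨ ring (bin (suc μ + d) k) (sgn k) ⟩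
        sgn k ℤ.* bin (suc μ + d) k ∎
        where
        f : ℕ → ℤ
        f a = bin (suc μ + d) a ℤ.* (sgn a ℤ.* revP D 1P (d ∸ a ⊓ d))
        ring : ∀ x y → x ℤ.* (y ℤ.* + 1) ≡ y ℤ.* x
        ring = solve-∀
        ring₀ : ∀ x y → x ℤ.* (y ℤ.* + 0) ≡ + 0
        ring₀ = solve-∀
        off : ∀ a → a ≢ k → f a ≡ + 0
        off a a≢k = trans (cong (λ z → bin (suc μ + d) a ℤ.* (sgn a ℤ.* z)) (revP-1P D (d ∸ a ⊓ d) exponent)) (ring₀ (bin (suc μ + d) a) (sgn a))
          where
          exponent : d ∸ a ⊓ d ≢ D
          exponent eq = a≢k (trans (sym a⊓d≡a) a⊓d≡k)
            where
            a⊓d≡k : a ⊓ d ≡ k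
            a⊓d≡k = trans (sym (ℕ.m∸[m∸n]≡n (ℕ.m⊓n≤n a d))) (trans (cong (d ∸_) eq) (ℕ.m+n∸m≡n D k))
            a⊓d≡a : a ⊓ d ≡ a
            a⊓d≡a with ℕ.≤-total a d
            ... | inj₁ a≤d = ℕ.m≤n⇒m⊓n≡m a≤d
            ... | inj₂ d≤a = contradiction (trans (sym (ℕ.m≥n⇒m⊓n≡n d≤a)) a⊓d≡k) (≢-sym (ℕ.<⇒≢ (s≤s (ℕ.m≤n+m k β))))

  kl-uniform : ∀ d → KLValue P μ d
  kl-uniform = <-rec (KLValue P μ) step
    where
    step : ∀ d → (∀ {e} → e < d → KLValue P μ e) → KLValue P μ d
    step d ih E r unif ∣E∣≡ β i refl with suc β ℕ.≤? i
    ... | yes β<i = value-high E r unif ∣E∣≡ β i refl β<i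
    ... | no  β≮i = trans (cong (+ suc β ℤ.*_) (kl-recurrence E r β i i≤β ih unif ∣E∣≡))
                          (recurrence-solution μ β i uniformValue uniformValue-vanish lower)
      where
      i≤β : i ≤ β
      i≤β = ℕ.≤-pred (ℕ.≰⇒> β≮i)
      lower : ∀ α → suc α ≤ i → ∀ j → + suc α ℤ.* uniformValue (suc α + j) j ≡ bin (suc μ + (suc α + j)) j ℤ.* U μ α j
      lower α α<i j with suc α ℕ.≤? j
      -- For large j the rank α + 1 + j may reach or exceed d, beyond the induction hypothesis; the
      -- degree bound settles these cases. For j ≤ α the rank is below d because α + 1 ≤ i ≤ β and j
      -- < i.
      ... | yes α<j = value-high ⊤ (uniformRank (suc α + j)) (λ _ _ → refl) (∣⊤∣≡n (suc μ + (suc α + j))) α j refl α<j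
      ... | no  α≮j = ih (ℕ.+-mono-≤-< (ℕ.≤-trans α<i (ℕ.m≤n⇒m≤1+n i≤β)) (ℕ.<-≤-trans (ℕ.≰⇒> α≮j) α<i))
                         ⊤ (uniformRank (suc α + j)) (λ _ _ → refl) (∣⊤∣≡n (suc μ + (suc α + j))) α j refl

-- The closed formula over ℚ

frac-cong : ∀ a b c d .{{_ : ℕ.NonZero b}} .{{_ : ℕ.NonZero d}} → a ℤ.* + d ≡ c ℤ.* + b → frac a b ≡ frac c d
frac-cong a (suc b) c (suc d) eq = ℚ.fromℚᵘ-cong {mkℚᵘ a b} {mkℚᵘ c d} (*≡* eq)

toℚᵘ-frac : ∀ a b → ℚ.toℚᵘ (frac a (suc b)) ℚᵘ.≃ mkℚᵘ a b
toℚᵘ-frac a b = ℚ.toℚᵘ-fromℚᵘ (mkℚᵘ a b)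

frac-+ : ∀ a c b → frac a (suc b) ℚ.+ frac c (suc b) ≡ frac (a ℤ.+ c) (suc b)
frac-+ a c b = ℚ.toℚᵘ-injective (begin-equality
  ℚ.toℚᵘ (frac a (suc b) ℚ.+ frac c (suc b))              ≃⟨ ℚ.toℚᵘ-homo-+ (frac a (suc b)) (frac c (suc b)) ⟩
  ℚ.toℚᵘ (frac a (suc b)) ℚᵘ.+ ℚ.toℚᵘ (frac c (suc b))    ≃⟨ ℚᵘ.+-cong (toℚᵘ-frac a b) (toℚᵘ-frac c b) ⟩
  mkℚᵘ a b ℚᵘ.+ mkℚᵘ c b                                  ≃⟨ *≡* (ring a c (+ suc b)) ⟩
  mkℚᵘ (a ℤ.+ c) b                                        ≃⟨ toℚᵘ-frac (a ℤ.+ c) b ⟨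
  ℚ.toℚᵘ (frac (a ℤ.+ c) (suc b))                         ∎)
  where
  open ℚᵘ.≤-Reasoning
  ring : ∀ a c d → (a ℤ.* d ℤ.+ c ℤ.* d) ℤ.* d ≡ (a ℤ.+ c) ℤ.* (d ℤ.* d)
  ring = solve-∀

toℚ-*-frac : ∀ x y z b → + suc b ℤ.* x ≡ y ℤ.* z → toℚ x ≡ toℚ y ℚ.* frac z (suc b)
toℚ-*-frac x y z b eq = ℚ.toℚᵘ-injective (begin-equality
  ℚ.toℚᵘ (frac x 1)                                ≃⟨ toℚᵘ-frac x 0 ⟩
  mkℚᵘ x 0                                         ≃⟨ *≡* cross ⟩
  mkℚᵘ y 0 ℚᵘ.* mkℚᵘ z b                           ≃⟨ ℚᵘ.*-cong (toℚᵘ-frac y 0) (toℚᵘ-frac z b) ⟨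
  ℚ.toℚᵘ (frac y 1) ℚᵘ.* ℚ.toℚᵘ (frac z (suc b))   ≃⟨ ℚ.toℚᵘ-homo-* (frac y 1) (frac z (suc b)) ⟨
  ℚ.toℚᵘ (frac y 1 ℚ.* frac z (suc b))             ∎)
  where
  open ℚᵘ.≤-Reasoning
  cross : x ℤ.* + suc (b + 0) ≡ (y ℤ.* z) ℤ.* + 1
  cross = trans (cong (λ t → x ℤ.* + suc t) (ℕ.+-identityʳ b))
            (trans (ℤ.*-comm x (+ suc b)) (trans eq (sym (ℤ.*-identityʳ (y ℤ.* z)))))

Σ₁-frac : ∀ b m f t → (∀ h → h < m → f (suc h) ≡ frac (t h) (suc b)) → Σ₁ m f ≡ frac (∑ m t) (suc b)
Σ₁-frac b zero    f t f≡ = frac-cong (+ 0) 1 (+ 0) (suc b) refl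
Σ₁-frac b (suc m) f t f≡ = begin
  Σ₁ m f ℚ.+ f (suc m)                          ≡⟨ cong₂ ℚ._+_ (Σ₁-frac b m f t (λ h h<m → f≡ h (ℕ.m<n⇒m<1+n h<m))) (f≡ m (ℕ.n<1+n m)) ⟩
  frac (∑ m t) (suc b) ℚ.+ frac (t m) (suc b)   ≡⟨ frac-+ (∑ m t) (t m) b ⟩
  frac (∑ m t ℤ.+ t m) (suc b)                  ≡⟨ cong (λ z → frac z (suc b)) (∑-last m t) ⟨
  frac (∑ (suc m) t) (suc b)                    ∎
  where open ≡-Reasoning

-- With D = suc β = g + z this says D / (D + y) · C(D + y, z) C(y + g, y) = C(D + y - 1, y) C(D, g).
absorb : ∀ y g z β → suc β ≡ g + z →
  + suc β ℤ.* (bin (suc β + y) z ℤ.* bin (y + g) y) ≡ + (suc β + y) ℤ.* (bin (β + y) y ℤ.* bin (suc β) g)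
absorb y g z β D≡ = *-cancel-fact z (*-cancel-fact y (*-cancel-fact g (*-cancel-fact β (begin
  + D ℤ.* (A ℤ.* B) ℤ.* fact z ℤ.* fact y ℤ.* fact g ℤ.* fact β
    ≡⟨ ring₁ (+ D) A B (fact z) (fact y) (fact g) (fact β) ⟩
  (A ℤ.* (fact z ℤ.* (B ℤ.* (fact y ℤ.* fact g)))) ℤ.* (+ D ℤ.* fact β)
    ≡⟨ cong₂ ℤ._*_ (trans (cong (λ t → A ℤ.* (fact z ℤ.* t)) (bin-fact y g)) (bin-fact′ z (y + g) index)) (sym (fact-suc β)) ⟩
  fact (D + y) ℤ.* fact D
    ≡⟨ cong₂ ℤ._*_ (trans (cong (+ (D + y) ℤ.*_) (bin-fact′ y β (ℕ.+-comm β y))) (sym (fact-suc (β + y)))) (bin-fact′ g z D≡) ⟨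
  (+ (D + y) ℤ.* (E ℤ.* (fact y ℤ.* fact β))) ℤ.* (F ℤ.* (fact g ℤ.* fact z))
    ≡⟨ ring₂ (+ (D + y)) E F (fact z) (fact y) (fact g) (fact β) ⟩
  + (D + y) ℤ.* (E ℤ.* F) ℤ.* fact z ℤ.* fact y ℤ.* fact g ℤ.* fact β ∎))))
  where
  open ≡-Reasoning
  D : ℕ
  D = suc β
  A B E F : ℤ
  A = bin (D + y) z
  B = bin (y + g) y
  E = bin (β + y) y
  F = bin D g
  index : D + y ≡ z + (y + g)
  index = trans (cong (_+ y) D≡) (solve-index y g z)
    where
    solve-index : ∀ y g z → g + z + y ≡ z + (y + g)
    solve-index = ℕ-Solver.solve-∀
  ring₁ : ∀ d A B z y g b → d ℤ.* (A ℤ.* B) ℤ.* z ℤ.* y ℤ.* g ℤ.* b ≡ (A ℤ.* (z ℤ.* (B ℤ.* (y ℤ.* g)))) ℤ.* (d ℤ.* b)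
  ring₁ = solve-∀
  ring₂ : ∀ d E F z y g b → (d ℤ.* (E ℤ.* (y ℤ.* b))) ℤ.* (F ℤ.* (g ℤ.* z)) ≡ d ℤ.* (E ℤ.* F) ℤ.* z ℤ.* y ℤ.* g ℤ.* b
  ring₂ = solve-∀

formulaTerm : ℕ → ℕ → ℕ → ℕ → ℚ
formulaTerm m d i h =
  frac ((ℤ.-1ℤ ℤ.^ (h + 1)) ℤ.* (+ h)
         ℤ.* (+ (binomℤ (d ∸ h ∸ i + m) (+ d ℤ.- + (2 ℕ.* i) ℤ.- + h)
                 ℕ.* ((m + i) C (m ∸ h)))))
       (d ∸ h ∸ i + m)

lower-index : ∀ β i h → + (suc β + i) ℤ.- + (2 ℕ.* i) ℤ.- + h ≡ suc β ℤ.⊖ (i + h)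
lower-index β i h = begin
  + (suc β + i) ℤ.- + (2 ℕ.* i) ℤ.- + h            ≡⟨ cong (λ z → (+ suc β ℤ.+ + i) ℤ.- + (i + z) ℤ.- + h) (ℕ.+-identityʳ i) ⟩
  (+ suc β ℤ.+ + i) ℤ.- (+ i ℤ.+ + i) ℤ.- + h      ≡⟨ ring (+ suc β) (+ i) (+ h) ⟩
  + suc β ℤ.- (+ i ℤ.+ + h)                        ≡⟨ ℤ.m-n≡m⊖n (suc β) (i + h) ⟩
  suc β ℤ.⊖ (i + h)                                ∎
  where
  open ≡-Reasoning
  ring : ∀ b i h → (b ℤ.+ i) ℤ.- (i ℤ.+ i) ℤ.- h ≡ b ℤ.- (i ℤ.+ h)
  ring = solve-∀

binomℤ-⊖ : ∀ n {a b} → a < b → binomℤ n (a ℤ.⊖ b) ≡ 0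
binomℤ-⊖ n {a} {b} a<b = trans (cong (binomℤ n) (ℤ.⊖-< a<b)) (negative (b ∸ a) (ℕ.m<n⇒0<n∸m a<b))
  where
  negative : ∀ x → 0 < x → binomℤ n (ℤ.- + x) ≡ 0
  negative (suc x) _ = refl

sgn-shift : ∀ h → sgn (suc h + 1) ≡ sgn h
sgn-shift h = trans (cong sgn (ℕ.+-comm (suc h) 1)) (ring (sgn h))
  where
  ring : ∀ s → ℤ.-1ℤ ℤ.* (ℤ.-1ℤ ℤ.* s) ≡ s
  ring = solve-∀

-- If i + h + 1 ≤ D = β + 1, the truncated subtractions are exact and `absorb` trades the
-- denominator for D, which is common to all summands. Otherwise the lower index is negative and
-- both sides are 0, with a denominator that is still positive thanks to the summand m.
formulaTerm-value : ∀ μ β i h → h ≤ μ →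
  formulaTerm (suc μ) (suc β + i) i (suc h) ≡ frac (coeff μ β h ℤ.* bin (suc β) (i + suc h)) (suc β)
formulaTerm-value μ β i h h≤μ = 
  frac-cong (numerator (binomℤ den lowerIndex)) den (coeff μ β h ℤ.* bin (suc β) g) (suc β) {{ℕ.>-nonZero 0<den}} cross
  where
  open ≡-Reasoning
  d den y g : ℕ
  d = suc β + i
  den = d ∸ suc h ∸ i + suc μ
  y = μ ∸ h
  g = i + suc h
  0<den : 0 < den
  0<den = ℕ.<-≤-trans (s≤s z≤n) (ℕ.m≤n+m (suc μ) (d ∸ suc h ∸ i))
  lowerIndex : ℤ
  lowerIndex = + d ℤ.- + (2 ℕ.* i) ℤ.- + suc h
  numerator : ℕ → ℤ
  numerator b = sgn (suc h + 1) ℤ.* + suc h ℤ.* + (b ℕ.* ((suc μ + i) C y))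

  m+i≡ : suc μ + i ≡ y + g
  m+i≡ = trans (cong (λ z → suc z + i) (sym (ℕ.m∸n+n≡m h≤μ))) (index y h i)
    where
    index : ∀ y h i → suc (y + h) + i ≡ y + (i + suc h)
    index = ℕ-Solver.solve-∀

  cross : numerator (binomℤ den lowerIndex) ℤ.* + suc β ≡ (coeff μ β h ℤ.* bin (suc β) g) ℤ.* + den
  cross with g ℕ.≤? suc β
  ... | no g≰β = trans
    (cong (λ b → numerator b ℤ.* + suc β) (trans (cong (binomℤ den) (lower-index β i (suc h))) (binomℤ-⊖ den (ℕ.≰⇒> g≰β))))
    (trans (cong (ℤ._* + suc β) (ℤ.*-zeroʳ (sgn (suc h + 1) ℤ.* + suc h)))
           (sym (trans (cong (λ t → (coeff μ β h ℤ.* t) ℤ.* + den) (n<k⇒bin≡0 (ℕ.≰⇒> g≰β))) (cong (ℤ._* + den) (ℤ.*-zeroʳ (coeff μ β h))))))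
  ... | yes g≤β = begin
    numerator (binomℤ den lowerIndex) ℤ.* + suc β
      ≡⟨ cong (λ b → numerator b ℤ.* + suc β) (cong₂ binomℤ den≡ (trans (lower-index β i (suc h)) (ℤ.⊖-≥ g≤β))) ⟩
    numerator ((suc β + y) C z) ℤ.* + suc β
      ≡⟨ cong₂ (λ s t → s ℤ.* + suc h ℤ.* t ℤ.* + suc β) (sgn-shift h) binomials ⟩
    weight h ℤ.* (bin (suc β + y) z ℤ.* bin (y + g) y) ℤ.* + suc β
      ≡⟨ ring₁ (weight h) (bin (suc β + y) z ℤ.* bin (y + g) y) (+ suc β) ⟩
    weight h ℤ.* (+ suc β ℤ.* (bin (suc β + y) z ℤ.* bin (y + g) y))
      ≡⟨ cong (weight h ℤ.*_) (absorb y g z β D≡) ⟩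
    weight h ℤ.* (+ (suc β + y) ℤ.* (bin (β + y) y ℤ.* bin (suc β) g))
      ≡⟨ ring₂ (weight h) (+ (suc β + y)) (bin (β + y) y) (bin (suc β) g) ⟩
    (coeff μ β h ℤ.* bin (suc β) g) ℤ.* + (suc β + y)
      ≡⟨ cong (λ t → (coeff μ β h ℤ.* bin (suc β) g) ℤ.* + t) den≡ ⟨
    (coeff μ β h ℤ.* bin (suc β) g) ℤ.* + den ∎
    where
    z : ℕ
    z = suc β ∸ g
    D≡ : suc β ≡ g + z
    D≡ = sym (ℕ.m+[n∸m]≡n g≤β)
    den≡ : den ≡ suc β + y
    den≡ = begin
      d ∸ suc h ∸ i + suc μ                     ≡⟨ cong (λ t → t + i ∸ suc h ∸ i + suc μ) D≡ ⟩
      g + z + i ∸ suc h ∸ i + suc μ             ≡⟨ cong (λ t → t ∸ suc h ∸ i + suc μ) (index₁ i h z) ⟩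
      suc h + (i + (i + z)) ∸ suc h ∸ i + suc μ ≡⟨ cong (λ t → t ∸ i + suc μ) (ℕ.m+n∸m≡n (suc h) (i + (i + z))) ⟩
      i + (i + z) ∸ i + suc μ                   ≡⟨ cong (_+ suc μ) (ℕ.m+n∸m≡n i (i + z)) ⟩
      i + z + suc μ                             ≡⟨ cong (λ t → i + z + suc t) (ℕ.m∸n+n≡m h≤μ) ⟨
      i + z + suc (y + h)                       ≡⟨ index₂ i h z y ⟩
      g + z + y                                 ≡⟨ cong (_+ y) D≡ ⟨
      suc β + y                                 ∎
      where
      index₁ : ∀ i h z → i + suc h + z + i ≡ suc h + (i + (i + z))
      index₁ = ℕ-Solver.solve-∀
      index₂ : ∀ i h z y → i + z + suc (y + h) ≡ i + suc h + z + y
      index₂ = ℕ-Solver.solve-∀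
    binomials : + (((suc β + y) C z) ℕ.* ((suc μ + i) C y)) ≡ bin (suc β + y) z ℤ.* bin (y + g) y
    binomials = trans (ℤ.pos-* ((suc β + y) C z) ((suc μ + i) C y))
      (cong₂ ℤ._*_ (sym (bin≡C (suc β + y) z)) (trans (sym (bin≡C (suc μ + i) y)) (cong (λ t → bin t y) m+i≡)))
    ring₁ : ∀ w x d → w ℤ.* x ℤ.* d ≡ w ℤ.* (d ℤ.* x)
    ring₁ = solve-∀
    ring₂ : ∀ w e x y → w ℤ.* (e ℤ.* (x ℤ.* y)) ≡ (w ℤ.* x ℤ.* y) ℤ.* e
    ring₂ = solve-∀

klFormula-value : ∀ μ β i x → + suc β ℤ.* x ≡ bin (suc μ + (suc β + i)) i ℤ.* U μ β i →
  toℚ x ≡ klFormula (suc μ) (suc β + i) i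
klFormula-value μ β i x eq = begin
  toℚ x
    ≡⟨ toℚ-*-frac x (+ ((d + suc μ) C i)) (U μ β i) β (trans eq (cong (ℤ._* U μ β i) binomial)) ⟩
  toℚ (+ ((d + suc μ) C i)) ℚ.* frac (U μ β i) (suc β)
    ≡⟨ cong (toℚ (+ ((d + suc μ) C i)) ℚ.*_)
         (Σ₁-frac β (suc μ) (formulaTerm (suc μ) d i) (λ h → coeff μ β h ℤ.* bin (suc β) (i + suc h))
           (λ h h<m → formulaTerm-value μ β i h (ℕ.≤-pred h<m))) ⟨
  klFormula (suc μ) d i ∎
  where
  open ≡-Reasoning
  d : ℕ
  d = suc β + i
  binomial : bin (suc μ + d) i ≡ + ((d + suc μ) C i)
  binomial = trans (cong (λ n → bin n i) (ℕ.+-comm (suc μ) d)) (bin≡C (d + suc μ) i)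

theorem1p3 : (P : (n : ℕ) → Subset n → (Subset n → ℕ) → Poly) → IsKLAssignment P →
    ∀ m d → 1 ≤ m → 1 ≤ d → ∀ i → i ≤ ⌊ (d ∸ 1) /2⌋ →
    toℚ (P (m + d) ⊤ (uniformRank d) i) ≡ klFormula m d i
theorem1p3 P kl (suc μ) (suc δ) _ _ i i≤ with ℕ.m≤n⇒∃[o]m+o≡n (ℕ.≤-trans i≤ (ℕ.⌊n/2⌋≤n δ))
... | β , refl rewrite ℕ.+-comm i β =
  klFormula-value μ β i (P (suc μ + d) ⊤ (uniformRank d) i)
    (kl-uniform kl μ d ⊤ (uniformRank d) (λ _ _ → refl) (∣⊤∣≡n (suc μ + d)) β i refl)
  where
  d : ℕ
  d = suc (β + i)
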